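{- For every integer $n > 2$ there is no distinct covering system all of whose moduli lie in the interval $[n, 6n]$. Equivalently, $k(n) > 6n$ for every integer $n>2$ for which $k(n)$ is defined.
   Context: A covering system (covering) is a finite set of congruences $\{x \equiv r_i \pmod{n_i} : i=1,\ldots,k\}$ with positive integer moduli $n_i$ such that every integer satisfies at least one of them. A covering is distinct if the moduli $n_i$ are pairwise distinct and all greater than $1$. For an integer $n \ge 2$ such that some distinct covering has all moduli at least $n$, $k(n)$ denotes the least positive integer such that there exists a distinct covering system with all moduli in the interval $[n, k(n)]$. -}

module Defs where

open import Data.Nat using (ℕ; _<_; _≤_; _*_)
open import Data.Integer as ℤ using (ℤ; +_; _-_)
open import Data.Integer.Divisibility using (_∣_)
open import Data.Product using (_×_; proj₁; proj₂; ∃)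
open import Data.List using (List; map)
open import Data.List.Relation.Unary.All using (All)
open import Data.List.Relation.Unary.Any using (Any)
open import Data.List.Relation.Unary.Unique.Propositional using (Unique)

Congruence : Set
Congruence = ℕ × ℤ

modulus : Congruence → ℕ
modulus = proj₁

residue : Congruence → ℤ
residue = proj₂

Satisfies : ℤ → Congruence → Set
Satisfies x c = (+ modulus c) ∣ (x - residue c)

IsCovering : List Congruence → Set
IsCovering cs = All (λ c → 0 < modulus c) cs × ((x : ℤ) → Any (Satisfies x) cs)

IsDistinctCovering : List Congruence → Set
IsDistinctCovering cs =
  IsCovering cs × Unique (map modulus cs) × All (λ c → 1 < modulus c) cs

ModuliIn : ℕ → ℕ → List Congruence → Set
ModuliIn a b cs = All (λ c → a ≤ modulus c × modulus c ≤ b) cs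

{-# OPTIONS --safe #-}
-- If fewer than p of the moduli are divisible by a power of the prime p, these moduli can be
-- discarded without losing the covering property. When y(y+1) > 5n, every prime p > y has fewer
-- than p multiples in [n , 6n], so only the y-smooth moduli remain, and it suffices to show that
-- the reciprocals of the y-smooth numbers in [n , 6n] sum to less than 1.
--
-- For n < 348927 this is computed: explicit removals for n ≤ 12, then windows [a , 6b] serving all
-- n in [a , b]. For larger n each smooth m is weighted by log m / log n ≥ 1. Writing log m as a sum
-- of log p over the prime powers p^j dividing m and exchanging the sums bounds the reciprocal sum
-- by (log n)⁻¹ (∑ log p / p^j) (log 6 + o(1)), about (log 6) / 2 < 1, since p ≤ y ≈ √(5n). The
-- Mertens sum ∑ log p / p^j is computed for y ≤ 374720; beyond that it is bounded by comparing
-- log N! with ∑ ⌊N / p^j⌋ log p for a power of two N near y, using ∏_{p ≤ y} p ≤ 4^y. Numbers m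
-- divisible by a large prime power with exponent at least 2 are few and estimated trivially.
--
-- Everything is carried out in ℕ: reciprocals 1/m become C ÷ m for a common multiple C or are
-- rounded up to recip Q m, and K log₂ x is rounded to an integer w with x ^ K ≤ 2 ^ w.

module Submission where

open import Defs
open import Data.Nat
open import Data.Nat.Properties
open import Data.Nat.Divisibility
open import Data.Nat.DivMod
open import Data.Nat.Primality
open import Data.Nat.Coprimality using (Coprime; coprime-divisor)
open import Data.Integer as ℤ using (ℤ) renaming (+_ to pos; ∣_∣ to abs)
import Data.Integer.Properties as ℤ
import Data.Integer.Divisibility.Signed as ℤˢ
open import Data.Bool using (Bool; T; true; false; if_then_else_; _∧_)
open import Data.List using (List; []; _∷_; map; _++_)
open import Data.List.Membership.Propositional using (_∈_)
open import Data.List.Membership.Propositional.Properties using (∈-map⁺; ∈-++⁺ˡ; ∈-++⁺ʳ)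
open import Data.List.Relation.Unary.All.Properties using (map⁺; ++⁺)
open import Data.List.Relation.Unary.All as All using (All; []; _∷_)
open import Data.List.Relation.Unary.Any as Any using (Any; here; there)
open import Data.List.Relation.Unary.AllPairs using (AllPairs; []; _∷_)
open import Data.List.Relation.Unary.Unique.Propositional using (Unique)
open import Data.Product using (_×_; ∃; _,_; proj₁; proj₂)
open import Data.Sum using (_⊎_; inj₁; inj₂; [_,_]′)
open import Data.Empty using (⊥)
open import Data.Unit using (⊤; tt)
open import Function using (_∘_; id)
open import Relation.Nullary using (¬_; Dec; yes; no; contradiction)
open import Relation.Nullary.Decidable using (_×-dec_; ¬?; does)
open import Relation.Unary using (Decidable)
open import Relation.Binary.PropositionalEquality
open import Data.Nat.Primality.Factorisation using (factorise; factorisationHasAllPrimeFactors)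
open import Data.Nat.ListAction using (product)
open import Data.Nat.ListAction.Properties using (product-++)
open import Data.Nat.Combinatorics using (k![n∸k]!∣n!)
open import Data.Nat.Tactic.RingSolver using (solve-∀)
import Data.Integer.Tactic.RingSolver as ℤSolver

-- Finite sums

-- The sum of `1 / m` over the multiples `m` of `d` in the window is close to `(log 6) / d` only
-- when `n / d` is large. For `d` comparable to `n` the constant `log 6 ≈ 1.792` may rise to
-- `1 + 1/2 + ... + 1/6 = 2.45`, and half of that exceeds 1. Hence only prime powers `d` with
-- `A * d < n`, for a fixed `A`, carry weight; there the constant is the sum of `1 / j` over
-- `A < j ≤ 6 (A + 1)`. Primes up to about `√(5n)` satisfy this for large `n`, and so do higher
-- powers up to 10000. Smooth numbers containing a power beyond these limits are split off and pay
-- the constant 2.45, which is affordable because the reciprocals of the forbidden powers have a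
-- small sum. The slack between `(log 6) / 2 ≈ 0.896` and 1 has to absorb every error. Estimating
-- the Mertens sum by factorials loses a bounded amount, that is, a proportion of order `1 / log n`.
-- This decays so slowly that a range of computed Mertens sums is placed between the enumeration of
-- smooth numbers and the factorial argument.

ι : {P : Set} → Dec P → ℕ → ℕ
ι (yes _) x = x
ι (no  _) x = 0

ι-≤ : {P : Set} (d : Dec P) (x : ℕ) → ι d x ≤ x
ι-≤ (yes _) x = ≤-refl
ι-≤ (no  _) x = z≤n

ι-mono : {P : Set} (d : Dec P) {x y : ℕ} → x ≤ y → ι d x ≤ ι d y
ι-mono (yes _) x≤y = x≤y
ι-mono (no  _) _   = z≤n

ι-yes : {P : Set} (d : Dec P) (x : ℕ) → P → ι d x ≡ x
ι-yes (yes _) x _ = refl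
ι-yes (no ¬p) x p = contradiction p ¬p

ι-no : {P : Set} (d : Dec P) (x : ℕ) → ¬ P → ι d x ≡ 0
ι-no (yes p) x ¬p = contradiction p ¬p
ι-no (no _)  x _  = refl

ι-implies : {P Q : Set} (d : Dec P) (e : Dec Q) (x : ℕ) → (P → Q) → ι d x ≤ ι e x
ι-implies (no _)  e x _ = z≤n
ι-implies (yes p) e x f = ≤-reflexive (sym (ι-yes e x (f p)))

ι-* : {P : Set} (d : Dec P) (k x : ℕ) → k * ι d x ≡ ι d (k * x)
ι-* (yes _) k x = refl
ι-* (no  _) k x = *-zeroʳ k

∑ : ℕ → ℕ → (ℕ → ℕ) → ℕ
∑ lo zero    f = 0
∑ lo (suc k) f = f lo + ∑ (suc lo) k f

syntax ∑ lo k (λ m → e) = ∑[ m from lo for k ] e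

∑-mono : ∀ lo k {f g : ℕ → ℕ} → (∀ m → lo ≤ m → m < lo + k → f m ≤ g m) → ∑ lo k f ≤ ∑ lo k g
∑-mono lo zero    h = z≤n
∑-mono lo (suc k) h = +-mono-≤
  (h lo ≤-refl (m<m+n lo z<s))
  (∑-mono (suc lo) k λ m l u → h m (<⇒≤ l) (subst (m <_) (sym (+-suc lo k)) u))

∑-mono′ : ∀ lo k {f g : ℕ → ℕ} → (∀ m → f m ≤ g m) → ∑ lo k f ≤ ∑ lo k g
∑-mono′ lo k h = ∑-mono lo k λ m _ _ → h m

∑-+ : ∀ lo k (f g : ℕ → ℕ) → ∑[ m from lo for k ] (f m + g m) ≡ ∑ lo k f + ∑ lo k g
∑-+ lo zero    f g = refl
∑-+ lo (suc k) f g rewrite ∑-+ (suc lo) k f g = interchange (f lo) (g lo) (∑ (suc lo) k f) (∑ (suc lo) k g)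
  where
  interchange : ∀ a b c d → a + b + (c + d) ≡ a + c + (b + d)
  interchange = solve-∀

∑-* : ∀ lo k c (f : ℕ → ℕ) → ∑[ m from lo for k ] (c * f m) ≡ c * ∑ lo k f
∑-* lo zero    c f = sym (*-zeroʳ c)
∑-* lo (suc k) c f rewrite ∑-* (suc lo) k c f = sym (*-distribˡ-+ c (f lo) (∑ (suc lo) k f))

∑-split : ∀ lo a b (f : ℕ → ℕ) → ∑ lo (a + b) f ≡ ∑ lo a f + ∑ (lo + a) b f
∑-split lo zero    b f rewrite +-identityʳ lo = refl
∑-split lo (suc a) b f rewrite ∑-split (suc lo) a b f | +-suc lo a =
  sym (+-assoc (f lo) (∑ (suc lo) a f) _)

∑-len-mono : ∀ lo {k l} (f : ℕ → ℕ) → k ≤ l → ∑ lo k f ≤ ∑ lo l f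
∑-len-mono lo {k} {l} f k≤l = subst (λ z → ∑ lo k f ≤ ∑ lo z f) (m+[n∸m]≡n k≤l)
  (≤-trans (m≤m+n _ _) (≤-reflexive (sym (∑-split lo k (l ∸ k) f))))

∑-⊆ : ∀ {lo k lo′ k′} (f : ℕ → ℕ) → lo′ ≤ lo → lo + k ≤ lo′ + k′ → ∑ lo k f ≤ ∑ lo′ k′ f
∑-⊆ {lo} {k} {lo′} {k′} f lo′≤lo hi≤hi′ = begin
  ∑ lo k f                                     ≤⟨ m≤n+m _ _ ⟩
  ∑ lo′ (lo ∸ lo′) f + ∑ lo k f                ≡⟨ cong (λ z → ∑ lo′ (lo ∸ lo′) f + ∑ z k f) (sym (m+[n∸m]≡n lo′≤lo)) ⟩
  ∑ lo′ (lo ∸ lo′) f + ∑ (lo′ + (lo ∸ lo′)) k f ≡⟨ sym (∑-split lo′ (lo ∸ lo′) k f) ⟩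
  ∑ lo′ ((lo ∸ lo′) + k) f                     ≤⟨ ∑-len-mono lo′ f (+-cancelˡ-≤ lo′ _ _ (begin
      lo′ + ((lo ∸ lo′) + k) ≡⟨ sym (+-assoc lo′ _ k) ⟩
      lo′ + (lo ∸ lo′) + k   ≡⟨ cong (_+ k) (m+[n∸m]≡n lo′≤lo) ⟩
      lo + k                 ≤⟨ hi≤hi′ ⟩
      lo′ + k′ ∎)) ⟩
  ∑ lo′ k′ f ∎
  where open ≤-Reasoning

∑-zero : ∀ lo k {f : ℕ → ℕ} → (∀ m → lo ≤ m → m < lo + k → f m ≡ 0) → ∑ lo k f ≡ 0
∑-zero lo k h = n≤0⇒n≡0 (≤-trans (∑-mono lo k λ m l u → ≤-reflexive (h m l u)) (≤-reflexive (∑-* lo k 0 λ _ → 0)))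

∑-one : ∀ lo k → ∑[ m from lo for k ] 1 ≡ k
∑-one lo zero    = refl
∑-one lo (suc k) = cong suc (∑-one (suc lo) k)

⅀ : {A : Set} → List A → (A → ℕ) → ℕ
⅀ []       f = 0
⅀ (x ∷ xs) f = f x + ⅀ xs f

syntax ⅀ xs (λ x → e) = ⅀[ x ∈ xs ] e

⅀-mono : {A : Set} (xs : List A) {f g : A → ℕ} → (∀ x → x ∈ xs → f x ≤ g x) → ⅀ xs f ≤ ⅀ xs g
⅀-mono []       h = z≤n
⅀-mono (x ∷ xs) h = +-mono-≤ (h x (here refl)) (⅀-mono xs λ y y∈ → h y (there y∈))

⅀-* : {A : Set} (xs : List A) (c : ℕ) (f : A → ℕ) → ⅀[ x ∈ xs ] (c * f x) ≡ c * ⅀ xs f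
⅀-* []       c f = sym (*-zeroʳ c)
⅀-* (x ∷ xs) c f rewrite ⅀-* xs c f = sym (*-distribˡ-+ c (f x) (⅀ xs f))

⅀-+ : {A : Set} (xs : List A) (f g : A → ℕ) → ⅀[ x ∈ xs ] (f x + g x) ≡ ⅀ xs f + ⅀ xs g
⅀-+ []       f g = refl
⅀-+ (x ∷ xs) f g rewrite ⅀-+ xs f g = interchange (f x) (g x) (⅀ xs f) (⅀ xs g)
  where
  interchange : ∀ a b c d → a + b + (c + d) ≡ a + c + (b + d)
  interchange = solve-∀

⅀-++ : {A : Set} (xs ys : List A) (f : A → ℕ) → ⅀ (xs ++ ys) f ≡ ⅀ xs f + ⅀ ys f
⅀-++ []       ys f = refl
⅀-++ (x ∷ xs) ys f rewrite ⅀-++ xs ys f = sym (+-assoc (f x) _ _)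

∑-⅀-swap : {A : Set} (lo k : ℕ) (xs : List A) (f : ℕ → A → ℕ) →
           ∑[ m from lo for k ] (⅀[ x ∈ xs ] f m x) ≡ ⅀[ x ∈ xs ] (∑[ m from lo for k ] f m x)
∑-⅀-swap lo k []       f = ∑-zero lo k λ _ _ _ → refl
∑-⅀-swap lo k (x ∷ xs) f = trans (∑-+ lo k (λ m → f m x) (λ m → ⅀ xs (f m)))
  (cong (∑ lo k (λ m → f m x) +_) (∑-⅀-swap lo k xs f))

∑-cong : ∀ lo k {f g : ℕ → ℕ} → (∀ m → f m ≡ g m) → ∑ lo k f ≡ ∑ lo k g
∑-cong lo zero    h = refl
∑-cong lo (suc k) h = cong₂ _+_ (h lo) (∑-cong (suc lo) k h)

⅀-cong : {A : Set} (xs : List A) {f g : A → ℕ} → (∀ x → f x ≡ g x) → ⅀ xs f ≡ ⅀ xs g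
⅀-cong []       h = refl
⅀-cong (x ∷ xs) h = cong₂ _+_ (h x) (⅀-cong xs h)

∑-∑-swap : ∀ lo k lo′ k′ (f : ℕ → ℕ → ℕ) →
           ∑[ m from lo for k ] (∑[ j from lo′ for k′ ] f m j) ≡ ∑[ j from lo′ for k′ ] (∑[ m from lo for k ] f m j)
∑-∑-swap lo k lo′ zero     f = ∑-zero lo k λ _ _ _ → refl
∑-∑-swap lo k lo′ (suc k′) f = trans (∑-+ lo k (λ m → f m lo′) (λ m → ∑ (suc lo′) k′ (f m)))
  (cong (∑ lo k (λ m → f m lo′) +_) (∑-∑-swap lo k (suc lo′) k′ f))

⅀-map : {A B : Set} (g : A → B) (xs : List A) (f : B → ℕ) → ⅀ (map g xs) f ≡ ⅀ xs (f ∘ g)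
⅀-map g []       f = refl
⅀-map g (x ∷ xs) f = cong (f (g x) +_) (⅀-map g xs f)

∑-extract : ∀ lo k (f : ℕ → ℕ) {a} → lo ≤ a → a < lo + k →
            f a + ∑[ m from lo for k ] ι (¬? (m ≟ a)) (f m) ≤ ∑ lo k f
∑-extract lo zero    f {a} l u = contradiction (subst (a <_) (+-identityʳ lo) u) (≤⇒≯ l)
∑-extract lo (suc k) f {a} l u with lo ≟ a
... | yes refl = +-monoʳ-≤ (f lo) (∑-mono′ (suc lo) k λ m → ι-≤ (¬? (m ≟ lo)) (f m))
... | no lo≢a  = begin
  f a + (f lo + R)  ≡⟨ x+[y+z] (f a) (f lo) R ⟩
  f lo + (f a + R)  ≤⟨ +-monoʳ-≤ (f lo) (∑-extract (suc lo) k f (≤∧≢⇒< l lo≢a) (subst (a <_) (+-suc lo k) u)) ⟩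
  f lo + ∑ (suc lo) k f ∎
  where
  open ≤-Reasoning
  R = ∑[ m from suc lo for k ] ι (¬? (m ≟ a)) (f m)
  x+[y+z] : ∀ x y z → x + (y + z) ≡ y + (x + z)
  x+[y+z] = solve-∀

-- Distinctness of the moduli enters the argument here. Setting `f` to 0 at the head of the list
-- does not affect the tail, where the head does not recur, and frees the value `f a` from the sum
-- over the interval.
⅀-unique-≤-∑ : ∀ lo k (f : ℕ → ℕ) {ms : List ℕ} → Unique ms →
               All (λ m → lo ≤ m × m < lo + k) ms → ⅀ ms f ≤ ∑ lo k f
⅀-unique-≤-∑ lo k f []          []             = z≤n
⅀-unique-≤-∑ lo k f {a ∷ ms} (a∉ ∷ uniq) ((l , u) ∷ inr) = begin
  f a + ⅀ ms f  ≤⟨ +-monoʳ-≤ (f a) (⅀-mono ms λ m m∈ → ≤-reflexive (sym (ι-yes (¬? (m ≟ a)) (f m)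
                      λ m≡a → All.lookup a∉ m∈ (sym m≡a)))) ⟩
  f a + ⅀ ms f′ ≤⟨ +-monoʳ-≤ (f a) (⅀-unique-≤-∑ lo k f′ uniq inr) ⟩
  f a + ∑ lo k f′ ≤⟨ ∑-extract lo k f l u ⟩
  ∑ lo k f ∎
  where
  open ≤-Reasoning
  f′ : ℕ → ℕ
  f′ m = ι (¬? (m ≟ a)) (f m)

module _ {Q : ℕ → Set} (Q? : Decidable Q) (d : ℕ)
         (sep : ∀ {s t} → s ≤ t → Q s → Q t → d ∣ t ∸ s) where

  -- Two solutions in an interval of length at most `d` would differ by a positive multiple of `d`
  -- smaller than `d`. The predicate `Q` will be a residue class, divisibility by `d`, or equality
  -- with a fixed number.
  separated-short : ∀ lo k → k ≤ d → ∑[ t from lo for k ] ι (Q? t) 1 ≤ 1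
  separated-short lo zero    k≤d = z≤n
  separated-short lo (suc k) k≤d with Q? lo
  ... | no _   = separated-short (suc lo) k (<⇒≤ k≤d)
  ... | yes qlo = s≤s (≤-reflexive (∑-zero (suc lo) k λ t l u → ι-no (Q? t) 1 λ qt →
          let 0<t-lo = m<n⇒0<n∸m l
              t-lo<d : t ∸ lo < d
              t-lo<d = ≤-trans (s≤s (≤-trans (∸-monoˡ-≤ lo (s≤s⁻¹ u)) (≤-reflexive (m+n∸m≡n lo k)))) k≤d
          in ≤⇒≯ (∣⇒≤ {{>-nonZero 0<t-lo}} (sep (<⇒≤ l) qlo qt)) t-lo<d))

  separated-count : ∀ lo k → ∑[ t from lo for k * d ] ι (Q? t) 1 ≤ k
  separated-count lo zero    = z≤n
  separated-count lo (suc k) = begin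
    ∑ lo (d + k * d) f                ≡⟨ ∑-split lo d (k * d) f ⟩
    ∑ lo d f + ∑ (lo + d) (k * d) f   ≤⟨ +-mono-≤ (separated-short lo d ≤-refl) (separated-count (lo + d) k) ⟩
    suc k                             ∎
    where
    open ≤-Reasoning
    f = λ t → ι (Q? t) 1

infixl 7 _÷_

-- The value 0 at divisor 0 keeps `÷-*-≤` free of a positivity hypothesis.
_÷_ : ℕ → ℕ → ℕ
c ÷ zero  = 0
c ÷ suc m = c / suc m

÷-*-≤ : ∀ c m → c ÷ m * m ≤ c
÷-*-≤ c zero    = z≤n
÷-*-≤ c (suc m) = m/n*n≤m c (suc m)

÷-exact : ∀ {c m} → 0 < m → m ∣ c → c ÷ m * m ≡ c
÷-exact {c} {suc m} _ m∣c = m/n*n≡m m∣c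

<-*-suc÷ : ∀ c {m} → 0 < m → c < suc (c ÷ m) * m
<-*-suc÷ c {suc m} _ = begin-strict
  c                                    ≡⟨ m≡m%n+[m/n]*n c (suc m) ⟩
  c % suc m + c / suc m * suc m        <⟨ +-monoˡ-< _ (m%n<n c (suc m)) ⟩
  suc m + c / suc m * suc m            ∎
  where open ≤-Reasoning

-- Removing the moduli divisible by a prime power

∣⇒∣∸ : ∀ {d s t} → s ≤ t → d ∣ s → d ∣ t → d ∣ t ∸ s
∣⇒∣∸ {d} {s} {t} s≤t d∣s d∣t = ∣m+n∣m⇒∣n (subst (d ∣_) (sym (m+[n∸m]≡n s≤t)) d∣t) d∣s

sat? : (x : ℤ) (c : Congruence) → Dec (Satisfies x c)
sat? x c = modulus c ∣? abs (x ℤ.- residue c)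

satisfies-difference : ∀ x {a b} c → a ≤ b → Satisfies (x ℤ.+ pos a) c → Satisfies (x ℤ.+ pos b) c → modulus c ∣ b ∸ a
satisfies-difference x {a} {b} c a≤b sa sb =
  subst (modulus c ∣_) (cong abs eq)
    (ℤˢ.∣⇒∣ᵤ (ℤˢ.∣m∣n⇒∣m-n (ℤˢ.∣ᵤ⇒∣ {pos (modulus c)} {x ℤ.+ pos b ℤ.- residue c} sb)
                            (ℤˢ.∣ᵤ⇒∣ {pos (modulus c)} {x ℤ.+ pos a ℤ.- residue c} sa)))
  where
  r = residue c
  cancel : ∀ x r a e → x ℤ.+ (a ℤ.+ e) ℤ.- r ℤ.- (x ℤ.+ a ℤ.- r) ≡ e
  cancel = ℤSolver.solve-∀
  eq : x ℤ.+ pos b ℤ.- r ℤ.- (x ℤ.+ pos a ℤ.- r) ≡ pos (b ∸ a)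
  eq = trans (cong (λ z → x ℤ.+ z ℤ.- r ℤ.- (x ℤ.+ pos a ℤ.- r))
                (trans (cong pos (sym (m+[n∸m]≡n a≤b))) (ℤ.pos-+ a (b ∸ a))))
             (cancel x r (pos a) (pos (b ∸ a)))

satisfies-shift : ∀ x {a} c → modulus c ∣ a → Satisfies (x ℤ.+ pos a) c → Satisfies x c
satisfies-shift x {a} c m∣a s =
  subst (λ z → modulus c ∣ abs z) (eq x (residue c) (pos a))
    (ℤˢ.∣⇒∣ᵤ (ℤˢ.∣m∣n⇒∣m-n (ℤˢ.∣ᵤ⇒∣ {pos (modulus c)} {x ℤ.+ pos a ℤ.- residue c} s) (ℤˢ.∣ᵤ⇒∣ {pos (modulus c)} {pos a} m∣a)))
  where
  eq : ∀ x r a → x ℤ.+ a ℤ.- r ℤ.- a ≡ x ℤ.- r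
  eq = ℤSolver.solve-∀

Covers : List Congruence → (ℕ → Set) → Set
Covers cs P = (x : ℤ) → Any (λ c → P (modulus c) × Satisfies x c) cs

-- Double counting of the pairs of an index `t` and a congruence satisfied by `X t`. The union bound
-- takes consecutive integers for `X`, the removal step an arithmetic progression.
covers-count : ∀ {cs P} (P? : Decidable P) → Covers cs P → (X : ℕ → ℤ) (k : ℕ) →
               k ≤ ⅀[ c ∈ cs ] ι (P? (modulus c)) (∑[ t from 0 for k ] ι (sat? (X t) c) 1)
covers-count {cs} {P} P? cov X k = begin
  k                                                        ≡⟨ sym (∑-one 0 k) ⟩
  ∑[ t from 0 for k ] 1                                    ≤⟨ ∑-mono′ 0 k (λ t → hit (X t) cs (cov (X t))) ⟩
  ∑[ t from 0 for k ] (⅀[ c ∈ cs ] ι (P? (modulus c)) (ι (sat? (X t) c) 1))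
                                                           ≡⟨ ∑-⅀-swap 0 k cs _ ⟩
  ⅀[ c ∈ cs ] (∑[ t from 0 for k ] ι (P? (modulus c)) (ι (sat? (X t) c) 1))
                                                           ≤⟨ ⅀-mono cs (λ c _ → pull c) ⟩
  ⅀[ c ∈ cs ] ι (P? (modulus c)) (∑[ t from 0 for k ] ι (sat? (X t) c) 1) ∎
  where
  open ≤-Reasoning
  hit : ∀ x ds → Any (λ c → P (modulus c) × Satisfies x c) ds → 1 ≤ ⅀[ c ∈ ds ] ι (P? (modulus c)) (ι (sat? x c) 1)
  hit x (c ∷ ds) (here (p , s)) rewrite ι-yes (P? (modulus c)) (ι (sat? x c) 1) p | ι-yes (sat? x c) 1 s = s≤s z≤n
  hit x (c ∷ ds) (there h) = ≤-trans (hit x ds h) (m≤n+m _ _)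
  pull : ∀ c → ∑[ t from 0 for k ] ι (P? (modulus c)) (ι (sat? (X t) c) 1) ≤
               ι (P? (modulus c)) (∑[ t from 0 for k ] ι (sat? (X t) c) 1)
  pull c with P? (modulus c)
  ... | yes _ = ≤-refl
  ... | no _  = ≤-reflexive (∑-zero 0 k λ _ _ _ → refl)

prime-to-part : ∀ {p} → Prime p → ∀ a m → ¬ p ^ suc a ∣ m → ∃ λ u → ¬ p ∣ u × m ∣ p ^ a * u
prime-to-part {p} pr a m q∤m with p ∣? m
... | no p∤m = m , p∤m , n∣m*n (p ^ a)
prime-to-part {p} pr zero m q∤m | yes p∣m = contradiction (subst (_∣ m) (sym (*-identityʳ p)) p∣m) q∤m
prime-to-part {p} pr (suc a) m q∤m | yes (divides m′ refl)
  with prime-to-part pr a m′ (λ q∣m′ → q∤m (subst (p ^ suc (suc a) ∣_) (*-comm p m′) (*-monoʳ-∣ p q∣m′)))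
... | u , p∤u , m′∣ = u , p∤u , subst₂ _∣_ (*-comm p m′) (sym (*-assoc p (p ^ a) u)) (*-monoʳ-∣ p m′∣)

-- A number not divisible by `p ^ suc a` has `p`-part at most `p ^ a`, so `p ^ a` times the product
-- of the prime-to-`p` parts works. As `p` does not divide `u`, the multiple itself is not divisible
-- by `p ^ suc a`.
common-multiple : ∀ {p} → Prime p → ∀ a (ms : List ℕ) →
                  ∃ λ u → ¬ p ∣ u × (∀ m → m ∈ ms → ¬ p ^ suc a ∣ m → m ∣ p ^ a * u)
common-multiple {p} pr a []       = 1 , (λ p∣1 → ¬prime[1] (subst Prime (∣1⇒≡1 p∣1) pr)) , λ _ ()
common-multiple {p} pr a (m ∷ ms) with common-multiple pr a ms | p ^ suc a ∣? m
... | u , p∤u , h | yes q∣m = u , p∤u , λ { _ (here refl) q∤ → contradiction q∣m q∤ ; x (there x∈) q∤ → h x x∈ q∤ }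
... | u , p∤u , h | no q∤m with prime-to-part pr a m q∤m
... | v , p∤v , m∣ = v * u , (λ p∣vu → [ p∤v , p∤u ]′ (euclidsLemma v u pr p∣vu)) , λ
  { _ (here refl) _  → subst (m ∣_) (*-assoc (p ^ a) v u) (∣m⇒∣m*n u m∣)
  ; x (there x∈) q∤ → ∣-trans (h x x∈ q∤) (*-monoʳ-∣ (p ^ a) (n∣m*n v)) }

-- With `d` the difference of two indices below `p`, this makes the translates by multiples of
-- `p ^ a * u` pairwise incongruent modulo `p ^ suc a`.
cancel-prime-to-part : ∀ {p} → Prime p → ∀ a d u → ¬ p ∣ u → p ^ suc a ∣ d * (p ^ a * u) → p ∣ d
cancel-prime-to-part {p} pr a d u p∤u q∣ =
  [ id , (λ p∣u → contradiction p∣u p∤u) ]′ (euclidsLemma d u pr (*-cancelˡ-∣ (p ^ a) p∣du))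
  where
  instance
    p≢0 = prime⇒nonZero pr
    pᵃ≢0 = m^n≢0 p a
  rearr : ∀ d b u → d * (b * u) ≡ b * (d * u)
  rearr = solve-∀
  p∣du : p ^ a * p ∣ p ^ a * (d * u)
  p∣du = subst₂ _∣_ (*-comm p (p ^ a)) (rearr d (p ^ a) u) q∣

module Window (cs : List Congruence) (lo k : ℕ)
              (uniq : Unique (map modulus cs))
              (inr : All (λ c → lo ≤ modulus c × modulus c < lo + k) cs) where

  moduli-sum : (f : ℕ → ℕ) → ⅀[ c ∈ cs ] f (modulus c) ≤ ∑ lo k f
  moduli-sum f = ≤-trans (≤-reflexive (sym (⅀-map modulus cs f))) (⅀-unique-≤-∑ lo k f uniq (map⁺ inr))

  -- An x left uncovered by the moduli not divisible by q = p^(a+1) yields the p points x + tE,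
  -- where E is a common multiple of those moduli with q ∤ E. A modulus divisible by q covers at
  -- most one of these points, so at least p such moduli are needed.
  remove-prime-power : ∀ {P} (P? : Decidable P) {p} → Prime p → ∀ a →
    ∑[ m from lo for k ] ι (P? m ×-dec (p ^ suc a ∣? m)) 1 < p →
    Covers cs P → Covers cs (λ m → P m × ¬ p ^ suc a ∣ m)
  remove-prime-power {P} P? {p} pr a few cov x
    with Any.any? (λ c → (P? (modulus c) ×-dec ¬? (p ^ suc a ∣? modulus c)) ×-dec sat? x c) cs
  ... | yes found = found
  ... | no ¬found = contradiction few (≤⇒≯ (begin
    p                                                          ≤⟨ covers-count P? cov X p ⟩
    ⅀[ c ∈ cs ] ι (P? (modulus c)) (∑[ t from 0 for p ] ι (sat? (X t) c) 1) ≤⟨ ⅀-mono cs bound ⟩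
    ⅀[ c ∈ cs ] ι (P? (modulus c) ×-dec (q ∣? modulus c)) 1    ≤⟨ moduli-sum (λ m → ι (P? m ×-dec (q ∣? m)) 1) ⟩
    ∑[ m from lo for k ] ι (P? m ×-dec (q ∣? m)) 1             ∎))
    where
    open ≤-Reasoning
    q = p ^ suc a
    cm = common-multiple pr a (map modulus cs)
    u = proj₁ cm
    E = p ^ a * u
    X : ℕ → ℤ
    X t = x ℤ.+ pos (t * E)
    sep : ∀ c → q ∣ modulus c → ∀ {s t} → s ≤ t → Satisfies (X s) c → Satisfies (X t) c → p ∣ t ∸ s
    sep c q∣c {s} {t} s≤t ss st = cancel-prime-to-part pr a (t ∸ s) u (proj₁ (proj₂ cm))
      (subst (q ∣_) (sym (*-distribʳ-∸ E t s))
        (∣-trans q∣c (satisfies-difference x c (*-monoˡ-≤ E s≤t) ss st)))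
    bound : ∀ c → c ∈ cs → ι (P? (modulus c)) (∑[ t from 0 for p ] ι (sat? (X t) c) 1) ≤
                            ι (P? (modulus c) ×-dec (q ∣? modulus c)) 1
    bound c c∈ = help (P? (modulus c)) (q ∣? modulus c)
      where
      help : (d : Dec (P (modulus c))) (e : Dec (q ∣ modulus c)) →
             ι d (∑[ t from 0 for p ] ι (sat? (X t) c) 1) ≤ ι (d ×-dec e) 1
      help (no _)  e = z≤n
      help (yes _) (yes q∣c) = separated-short (λ t → sat? (X t) c) p (sep c q∣c) 0 p ≤-refl
      help (yes Pc) (no q∤c) = ≤-reflexive (∑-zero 0 p λ t _ _ → ι-no (sat? (X t) c) 1 λ s →
        ¬found (Any.map (λ { refl → (Pc , q∤c) , satisfies-shift x c
          (∣n⇒∣m*n t (proj₂ (proj₂ cm) (modulus c) (∈-map⁺ modulus c∈) q∤c)) s }) c∈))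

  -- The density argument in finite form: among `C` consecutive integers, a congruence whose modulus
  -- `m` divides `C` is satisfied by at most `C ÷ m`.
  union-bound : ∀ {P} (P? : Decidable P) → Covers cs P → 0 < lo →
                ∀ C → (∀ m → lo ≤ m → m < lo + k → m ∣ C) →
                C ≤ ∑[ m from lo for k ] ι (P? m) (C ÷ m)
  union-bound P? cov 0<lo C div = begin
    C                                                            ≤⟨ covers-count P? cov X C ⟩
    ⅀[ c ∈ cs ] ι (P? (modulus c)) (∑[ t from 0 for C ] ι (sat? (X t) c) 1)
                                                                 ≤⟨ ⅀-mono cs (λ c c∈ → ι-mono (P? (modulus c)) (bound c (All.lookup inr c∈))) ⟩
    ⅀[ c ∈ cs ] ι (P? (modulus c)) (C ÷ modulus c)               ≤⟨ moduli-sum (λ m → ι (P? m) (C ÷ m)) ⟩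
    ∑[ m from lo for k ] ι (P? m) (C ÷ m)                        ∎
    where
    open ≤-Reasoning
    X : ℕ → ℤ
    -- The summand `pos 0` gives these points the shape that `satisfies-difference` expects.
    X t = pos 0 ℤ.+ pos t
    bound : ∀ c → lo ≤ modulus c × modulus c < lo + k → ∑[ t from 0 for C ] ι (sat? (X t) c) 1 ≤ C ÷ modulus c
    bound c (l , u) = subst (λ z → ∑[ t from 0 for z ] ι (sat? (X t) c) 1 ≤ C ÷ modulus c)
      (÷-exact (≤-trans 0<lo l) (div (modulus c) l u))
      (separated-count (λ t → sat? (X t) c) (modulus c) (satisfies-difference (pos 0) c) 0 (C ÷ modulus c))

-- Restriction to smooth moduli

multiples-count : ∀ lo k d j → k ≤ j * d → ∑[ m from lo for k ] ι (d ∣? m) 1 ≤ j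
multiples-count lo k d j k≤jd = ≤-trans (∑-len-mono lo _ k≤jd)
  (separated-count (λ m → d ∣? m) d ∣⇒∣∸ lo j)

-- The conjuncts accumulate as the primes above `y` are removed one after the other, so each stage
-- is a predicate to which `remove-prime-power` applies. Demanding primality inside the negation
-- makes a composite `y + suc k` impose nothing.
NoPrimeIn : ℕ → ℕ → ℕ → Set
NoPrimeIn y zero    m = ⊤
NoPrimeIn y (suc k) m = NoPrimeIn y k m × ¬ (Prime (y + suc k) × y + suc k ∣ m)

noPrimeIn? : ∀ y k → Decidable (NoPrimeIn y k)
noPrimeIn? y zero    m = yes tt
noPrimeIn? y (suc k) m = noPrimeIn? y k m ×-dec ¬? (prime? (y + suc k) ×-dec (y + suc k ∣? m))

noPrimeIn-lookup : ∀ y k {m p} → NoPrimeIn y k m → y < p → p ≤ y + k → Prime p → ¬ p ∣ m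
noPrimeIn-lookup y zero    {m} {p} _         l u pr p∣m = contradiction (subst (p ≤_) (+-identityʳ y) u) (<⇒≱ l)
noPrimeIn-lookup y (suc k) {m} {p} (np , h)  l u pr p∣m with p ≟ y + suc k
... | yes refl = h (pr , p∣m)
... | no p≢    = noPrimeIn-lookup y k np l (s≤s⁻¹ (subst (p <_) (+-suc y k) (≤∧≢⇒< u p≢))) pr p∣m

Smooth : ℕ → ℕ → Set
Smooth y m = ∀ {p} → Prime p → p ∣ m → p ≤ y

noPrimeIn⇒smooth : ∀ y k {m} → 0 < m → m ≤ y + k → NoPrimeIn y k m → Smooth y m
noPrimeIn⇒smooth y k {m} 0<m m≤ np {p} pr p∣m with p ≤? y
... | yes p≤y = p≤y
... | no p≰y  = contradiction p∣m (noPrimeIn-lookup y k np (≰⇒> p≰y) (≤-trans (∣⇒≤ {{>-nonZero 0<m}} p∣m) m≤) pr)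

distinct-covering-⊤ : ∀ {cs} → IsDistinctCovering cs → Covers cs (λ _ → ⊤)
distinct-covering-⊤ ((_ , cov) , _) x = Any.map (tt ,_) (cov x)

weaken-covers : ∀ {cs P Q} → (∀ {m} → P m → Q m) → Covers cs P → Covers cs Q
weaken-covers f cov x = Any.map (λ { (p , s) → f p , s }) (cov x)

-- The window [n , 6n] as it appears in ∑: it starts at n and has 5n + 1 elements.
window-end : ∀ n → n + suc (5 * n) ≡ suc (6 * n)
window-end = solve-∀

window-divides : ∀ {n} → 0 < n → ∀ m → n ≤ m → m < n + suc (5 * n) → m ∣ (6 * n) !
window-divides {n} 0<n zero    l u = contradiction (≤-trans 0<n l) λ ()
window-divides {n} 0<n (suc m) l u = ∣-trans (m∣m*n (m !)) (m≤n⇒m!∣n! (s≤s⁻¹ (subst (suc m <_) (window-end n) u)))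

module Moduli (n : ℕ) (cs : List Congruence) (dc : IsDistinctCovering cs) (inn : ModuliIn n (6 * n) cs) where

  in-window : All (λ c → n ≤ modulus c × modulus c < n + suc (5 * n)) cs
  in-window = All.map (λ { {c} (l , u) → l , subst (modulus c <_) (sym (window-end n)) (s≤s u) }) inn

  open Window cs n (suc (5 * n)) (proj₁ (proj₂ dc)) in-window public

  remove-large-primes : ∀ y → suc (5 * n) ≤ y * suc y → ∀ k → Covers cs (NoPrimeIn y k)
  remove-large-primes y y-big zero    = distinct-covering-⊤ dc
  remove-large-primes y y-big (suc k) with prime? (y + suc k)
  ... | no ¬pr = weaken-covers (λ np → np , λ { (pr , _) → ¬pr pr }) (remove-large-primes y y-big k)
  ... | yes pr = weaken-covers (λ { {m} (np , h) → np , λ { (_ , p∣m) → h (subst (_∣ m) (sym (^-identityʳ p)) p∣m) } })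
    (remove-prime-power (noPrimeIn? y k) pr 0 few (remove-large-primes y y-big k))
    where
    open ≤-Reasoning
    p = y + suc k
    few : ∑[ m from n for suc (5 * n) ] ι (noPrimeIn? y k m ×-dec (p ^ 1 ∣? m)) 1 < p
    few = begin-strict
      ∑[ m from n for suc (5 * n) ] ι (noPrimeIn? y k m ×-dec (p ^ 1 ∣? m)) 1
        ≤⟨ ∑-mono′ n (suc (5 * n)) (λ m → ι-implies (noPrimeIn? y k m ×-dec (p ^ 1 ∣? m)) (p ∣? m) 1
             λ { (_ , p∣m) → subst (_∣ m) (^-identityʳ p) p∣m }) ⟩
      ∑[ m from n for suc (5 * n) ] ι (p ∣? m) 1
        -- The window fits into `p - 1 = y + k` blocks of length `p`, because
        -- `y * suc y ≤ (p - 1) * p`.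
        ≤⟨ multiples-count n (suc (5 * n)) p (y + k) (begin
             suc (5 * n)   ≤⟨ y-big ⟩
             y * suc y     ≤⟨ *-mono-≤ (m≤m+n y k) (≤-trans (s≤s (m≤m+n y k)) (≤-reflexive (sym (+-suc y k)))) ⟩
             (y + k) * p   ∎) ⟩
      y + k     <⟨ ≤-reflexive (sym (+-suc y k)) ⟩
      p         ∎

  -- The factorial serving as common multiple is eliminated: after multiplication by `Q`, each
  -- `Q * (C ÷ m)` is at most `w m * C`, and `C` cancels. What remains involves only numbers of the
  -- size of `Q` and is fit for computation.
  reciprocal-sum : ∀ {P} (P? : Decidable P) → Covers cs P → 0 < n → ∀ Q (w : ℕ → ℕ) →
    (∀ m → n ≤ m → Q ≤ w m * m) → Q ≤ ∑[ m from n for suc (5 * n) ] ι (P? m) (w m)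
  reciprocal-sum P? cov 0<n Q w w-big = *-cancelʳ-≤ Q _ C {{C≢0}} (begin
    Q * C
      ≤⟨ *-monoʳ-≤ Q (union-bound P? cov 0<n C (window-divides 0<n)) ⟩
    Q * ∑[ m from n for suc (5 * n) ] ι (P? m) (C ÷ m)
      ≡⟨ sym (∑-* n (suc (5 * n)) Q _) ⟩
    ∑[ m from n for suc (5 * n) ] (Q * ι (P? m) (C ÷ m))
      ≤⟨ ∑-mono n (suc (5 * n)) (λ m l _ → begin
           Q * ι (P? m) (C ÷ m)       ≡⟨ ι-* (P? m) Q (C ÷ m) ⟩
           ι (P? m) (Q * (C ÷ m))     ≤⟨ ι-mono (P? m) (begin
             Q * (C ÷ m)              ≤⟨ *-monoˡ-≤ (C ÷ m) (w-big m l) ⟩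
             w m * m * (C ÷ m)        ≡⟨ rearr (w m) m (C ÷ m) ⟩
             w m * (C ÷ m * m)        ≤⟨ *-monoʳ-≤ (w m) (÷-*-≤ C m) ⟩
             w m * C                  ≡⟨ *-comm (w m) C ⟩
             C * w m                  ∎) ⟩
           ι (P? m) (C * w m)         ≡⟨ sym (ι-* (P? m) C (w m)) ⟩
           C * ι (P? m) (w m)         ∎) ⟩
    ∑[ m from n for suc (5 * n) ] (C * ι (P? m) (w m))
      ≡⟨ ∑-* n (suc (5 * n)) C _ ⟩
    C * ∑[ m from n for suc (5 * n) ] ι (P? m) (w m)
      ≡⟨ *-comm C _ ⟩
    ∑[ m from n for suc (5 * n) ] ι (P? m) (w m) * C ∎)
    where
    open ≤-Reasoning
    C = (6 * n) !
    C≢0 : NonZero C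
    C≢0 = (6 * n) !≢0
    rearr : ∀ a b c → a * b * c ≡ a * (c * b)
    rearr = solve-∀

recip : ℕ → ℕ → ℕ
recip Q m = suc (Q ÷ m)

recip-big : ∀ Q {m} → 0 < m → Q ≤ recip Q m * m
recip-big Q 0<m = <⇒≤ (<-*-suc÷ Q 0<m)

-- Small n: explicit lists of removed prime powers

∧-true : ∀ {a b} → (a ∧ b) ≡ true → a ≡ true × b ≡ true
∧-true {true} {true} refl = refl , refl

<ᵇ-true : ∀ {m n} → (m <ᵇ n) ≡ true → m < n
<ᵇ-true {m} {n} eq = <ᵇ⇒< m n (subst T (sym eq) tt)

does-true : {P : Set} (d : Dec P) → does d ≡ true → P
does-true (yes p) _ = p

-- An entry (p , a) stands for the prime power p ^ suc a; the head of the list is removed last.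
Survives : List (ℕ × ℕ) → ℕ → Set
Survives []             m = ⊤
Survives ((p , a) ∷ rs) m = Survives rs m × ¬ p ^ suc a ∣ m

survives? : ∀ rs → Decidable (Survives rs)
survives? []             m = yes tt
survives? ((p , a) ∷ rs) m = survives? rs m ×-dec ¬? (p ^ suc a ∣? m)

removable : ℕ → List (ℕ × ℕ) → Bool
removable n []             = true
removable n ((p , a) ∷ rs) = removable n rs ∧ (does (prime? p) ∧
  (∑[ m from n for suc (5 * n) ] ι (survives? rs m ×-dec (p ^ suc a ∣? m)) 1 <ᵇ p))

light : ℕ → List (ℕ × ℕ) → Bool
light n rs = ∑[ m from n for suc (5 * n) ] ι (survives? rs m) (recip 1000000 m) <ᵇ 1000000

NoCovering : ℕ → Set
NoCovering n = ∀ cs → IsDistinctCovering cs → ModuliIn n (6 * n) cs → ⊥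

removal-list-suffices : ∀ n rs → 0 < n → removable n rs ∧ light n rs ≡ true → NoCovering n
removal-list-suffices n rs 0<n ok cs dc inn = <⇒≱ (<ᵇ-true (proj₂ (∧-true {removable n rs} ok)))
  (reciprocal-sum (survives? rs) (covers rs (proj₁ (∧-true ok))) 0<n 1000000 (recip 1000000)
    λ m l → recip-big 1000000 (≤-trans 0<n l))
  where
  open Moduli n cs dc inn
  covers : ∀ rs → removable n rs ≡ true → Covers cs (Survives rs)
  covers []             _  = distinct-covering-⊤ dc
  covers ((p , a) ∷ rs) ok =
    let ok₁ , ok₂ = ∧-true {removable n rs} ok
        pr , few  = ∧-true {does (prime? p)} ok₂
    in remove-prime-power (survives? rs) (does-true (prime? p) pr) a (<ᵇ-true few) (covers rs ok₁)

-- Medium n: enumeration of the smooth numbers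

prime-divisor : ∀ {s} → 1 < s → ∃ λ p → Prime p × p ∣ s
prime-divisor {s} 1<s with factorise s {{>-nonZero (<-trans z<s 1<s)}}
... | record { factors = []     ; isFactorisation = refl ; factorsPrime = _ } = contradiction 1<s λ { (s≤s ()) }
... | record { factors = p ∷ ps ; isFactorisation = refl ; factorsPrime = pr ∷ _ } = p , pr , m∣m*n (product ps)

module Enumeration (lo k Q : ℕ) where

  leaf : ℕ → ℕ
  leaf c = if c <ᵇ lo then 0 else recip Q c

  -- Depth-first search through the products `c * s` with all prime factors of `s` in `ps`: either
  -- `p` is dropped for good or one more factor `p` is taken. Once `c * p` leaves the window, so do
  -- all larger factors, and only `c` is left. Exhausted fuel yields the sum over the whole window,
  -- which is a valid bound for any amount of fuel.
  enumerate : ℕ → List ℕ → ℕ → ℕ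
  enumerate zero       ps       c = ∑ lo k (recip Q)
  enumerate (suc fuel) []       c = leaf c
  enumerate (suc fuel) (p ∷ ps) c =
    if c * p <ᵇ lo + k then enumerate fuel ps c + enumerate fuel (p ∷ ps) (c * p) else leaf c

  _ProductOf_·_ : ℕ → ℕ → List ℕ → Set
  m ProductOf c · ps = ∃ λ s → m ≡ c * s × (∀ {p} → Prime p → p ∣ s → p ∈ ps)

  ∑-leaf : ∀ c (f : ℕ → ℕ) → (∀ m → f m ≤ recip Q m) →
           (∀ m → lo ≤ m → m < lo + k → f m ≢ 0 → m ≡ c) → ∑ lo k f ≤ leaf c
  ∑-leaf c f f≤ supp with c <ᵇ lo in eq
  ... | true  = ≤-reflexive (∑-zero lo k λ m l u → zero-at m l u (f m ≟ 0))
    where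
    zero-at : ∀ m → lo ≤ m → m < lo + k → Dec (f m ≡ 0) → f m ≡ 0
    zero-at m l u (yes z) = z
    zero-at m l u (no nz) = contradiction (subst (lo ≤_) (supp m l u nz) l) (<⇒≱ (<ᵇ-true eq))
  ... | false = begin
    ∑ lo k f                                          ≤⟨ ∑-mono lo k (λ m l u → at m l u (f m ≟ 0)) ⟩
    ∑[ m from lo for k ] (recip Q c * ι (m ≟ c) 1)    ≡⟨ ∑-* lo k (recip Q c) _ ⟩
    recip Q c * ∑[ m from lo for k ] ι (m ≟ c) 1      ≤⟨ *-monoʳ-≤ (recip Q c) (separated-short (_≟ c) k
                                                           (λ { {s} _ refl refl → subst (k ∣_) (sym (n∸n≡0 s)) (k ∣0) }) lo k ≤-refl) ⟩
    recip Q c * 1                                     ≡⟨ *-identityʳ _ ⟩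
    recip Q c                                         ∎
    where
    open ≤-Reasoning
    at : ∀ m → lo ≤ m → m < lo + k → Dec (f m ≡ 0) → f m ≤ recip Q c * ι (m ≟ c) 1
    at m l u (yes z) = subst (_≤ _) (sym z) z≤n
    at m l u (no nz) with supp m l u nz
    ... | refl = ≤-trans (f≤ m) (≤-reflexive (sym (trans (cong (recip Q m *_) (ι-yes (m ≟ m) 1 refl)) (*-identityʳ _))))

  -- The two branches correspond to the part `f₂` of `f` on the numbers not divisible by `c * p` and
  -- the part `f₁` on its multiples. Stating the bound for every `f` with suitable support lets the
  -- induction pass to these parts.
  ∑-enumerate : 0 < lo → ∀ fuel ps c → 0 < c → AllPairs _≤_ ps → (f : ℕ → ℕ) → (∀ m → f m ≤ recip Q m) →
                (∀ m → lo ≤ m → m < lo + k → f m ≢ 0 → m ProductOf c · ps) → ∑ lo k f ≤ enumerate fuel ps c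
  ∑-enumerate 0<lo zero       ps c 0<c sorted f f≤ supp = ∑-mono′ lo k f≤
  ∑-enumerate 0<lo (suc fuel) [] c 0<c sorted f f≤ supp = ∑-leaf c f f≤ λ m l u nz → only-c m l (supp m l u nz)
    where
    only-c : ∀ m → lo ≤ m → m ProductOf c · [] → m ≡ c
    only-c m l (0 , refl , h) = contradiction (subst (lo ≤_) (*-zeroʳ c) l) (<⇒≱ 0<lo)
    only-c m l (1 , refl , h) = *-identityʳ c
    only-c m l (suc (suc s) , refl , h) with prime-divisor {suc (suc s)} (s≤s z<s)
    ... | p , pr , p∣s with h pr p∣s
    ... | ()
  ∑-enumerate 0<lo (suc fuel) (p ∷ ps) c 0<c sorted f f≤ supp with c * p <ᵇ lo + k in eq
  ... | false = ∑-leaf c f f≤ λ m l u nz → only-c m l u (supp m l u nz)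
    where
    only-c : ∀ m → lo ≤ m → m < lo + k → m ProductOf c · (p ∷ ps) → m ≡ c
    only-c m l u (0 , refl , h) = contradiction (subst (lo ≤_) (*-zeroʳ c) l) (<⇒≱ 0<lo)
    only-c m l u (1 , refl , h) = *-identityʳ c
    only-c m l u (suc (suc s) , refl , h) with prime-divisor {suc (suc s)} (s≤s z<s)
    -- Here `c * p ≤ c * r ≤ c * s = m`, as `p` heads a sorted list containing `r`; so `m` would lie
    -- beyond the window.
    ... | r , pr , r∣s = contradiction (subst T eq (<⇒<ᵇ (≤-<-trans (*-monoʳ-≤ c (≤-trans (p≤r (h pr r∣s) sorted) (∣⇒≤ r∣s))) u))) λ ()
      where
      p≤r : ∀ {r} → r ∈ p ∷ ps → AllPairs _≤_ (p ∷ ps) → p ≤ r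
      p≤r (here refl) _        = ≤-refl
      p≤r (there r∈)  (a ∷ _)  = All.lookup a r∈
  ... | true = begin
    ∑ lo k f                                        ≤⟨ ∑-mono′ lo k split ⟩
    ∑[ m from lo for k ] (f₂ m + f₁ m)              ≡⟨ ∑-+ lo k f₂ f₁ ⟩
    ∑ lo k f₂ + ∑ lo k f₁
      ≤⟨ +-mono-≤ (∑-enumerate 0<lo fuel ps c 0<c (tail sorted) f₂ (λ m → ≤-trans (ι-≤ (¬? (c * p ∣? m)) (f m)) (f≤ m)) supp₂)
                  (∑-enumerate′ (0 <? p)) ⟩
    enumerate fuel ps c + enumerate fuel (p ∷ ps) (c * p) ∎
    where
    open ≤-Reasoning
    tail : AllPairs _≤_ (p ∷ ps) → AllPairs _≤_ ps
    tail (_ ∷ s) = s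
    f₁ f₂ : ℕ → ℕ
    f₁ m = ι (c * p ∣? m) (f m)
    f₂ m = ι (¬? (c * p ∣? m)) (f m)
    split : ∀ m → f m ≤ f₂ m + f₁ m
    split m with c * p ∣? m
    ... | yes _ = ≤-refl
    ... | no _  = m≤m+n _ _
    supp₂ : ∀ m → lo ≤ m → m < lo + k → f₂ m ≢ 0 → m ProductOf c · ps
    supp₂ m l u nz with c * p ∣? m
    ... | yes _ = contradiction refl nz
    ... | no ∤m with supp m l u nz
    ... | s , refl , h = s , refl , λ pr q∣s → other (h pr q∣s) q∣s
      where
      other : ∀ {q} → q ∈ p ∷ ps → q ∣ s → q ∈ ps
      other (here refl) q∣s = contradiction (*-monoʳ-∣ c q∣s) ∤m
      other (there q∈)  _   = q∈
    supp₁ : ∀ m → lo ≤ m → m < lo + k → f₁ m ≢ 0 → m ProductOf c * p · (p ∷ ps)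
    supp₁ m l u nz with c * p ∣? m
    ... | no _  = contradiction refl nz
    ... | yes cp∣m with supp m l u nz
    ... | s , refl , h with *-cancelˡ-∣ c {{>-nonZero 0<c}} cp∣m
    ... | divides s′ refl = s′ , trans (cong (c *_) (*-comm s′ p)) (sym (*-assoc c p s′)) , λ pr q∣s′ → h pr (∣m⇒∣m*n p q∣s′)
    ∑-enumerate′ : Dec (0 < p) → ∑ lo k f₁ ≤ enumerate fuel (p ∷ ps) (c * p)
    ∑-enumerate′ (yes 0<p) = ∑-enumerate 0<lo fuel (p ∷ ps) (c * p) (*-mono-< 0<c 0<p) sorted f₁
      (λ m → ≤-trans (ι-≤ (c * p ∣? m) (f m)) (f≤ m)) supp₁
    -- The entries of the list may be arbitrary numbers. For `p = 0` the only multiple of `c * p` is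
    -- 0, which lies below `lo`.
    ∑-enumerate′ (no p≯0) = ≤-trans (≤-reflexive (∑-zero lo k λ m l u → ι-no (c * p ∣? m) (f m) (λ cp∣m →
      <⇒≱ (≤-trans 0<lo l) (≤-reflexive (0∣⇒≡0 (subst (_∣ m) (trans (cong (c *_) (n≤0⇒n≡0 (≮⇒≥ p≯0))) (*-zeroʳ c)) cp∣m)))))) z≤n

-- The prime powers 49, 25, 27, 64 and the primes from 11 to 71. Each has fewer than `p` multiples
-- up to `72 = 6 * 12`, so it can be removed for every `n ≤ 12`.
removed-throughout : List (ℕ × ℕ)
removed-throughout = (7 , 1) ∷ (5 , 1) ∷ (3 , 2) ∷ (2 , 5) ∷ map (_, 0)
  (11 ∷ 13 ∷ 17 ∷ 19 ∷ 23 ∷ 29 ∷ 31 ∷ 37 ∷ 41 ∷ 43 ∷ 47 ∷ 53 ∷ 59 ∷ 61 ∷ 67 ∷ 71 ∷ [])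

noCovering-3-12 : ∀ i → i < 10 → NoCovering (3 + i)
-- The surviving moduli are 3, 4, 6, 8, 12, with reciprocal sum 23/24.
noCovering-3-12 0 _ = removal-list-suffices 3 ((7 , 0) ∷ (5 , 0) ∷ (3 , 1) ∷ (2 , 3) ∷ removed-throughout) z<s refl
noCovering-3-12 1 _ = removal-list-suffices 4 ((5 , 0) ∷ (3 , 1) ∷ removed-throughout) z<s refl
-- The order matters: `[5 , 30]` contains three multiples of 9, but only two once 27 is gone.
noCovering-3-12 2 _ = removal-list-suffices 5 ((7 , 0) ∷ (3 , 1) ∷ removed-throughout) z<s refl
noCovering-3-12 3 _ = removal-list-suffices 6 ((7 , 0) ∷ removed-throughout) z<s refl
noCovering-3-12 4 _ = removal-list-suffices 7 ((7 , 0) ∷ removed-throughout) z<s refl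
noCovering-3-12 5 _ = removal-list-suffices 8 ((7 , 0) ∷ removed-throughout) z<s refl
noCovering-3-12 6 _ = removal-list-suffices 9 removed-throughout z<s refl
noCovering-3-12 7 _ = removal-list-suffices 10 removed-throughout z<s refl
noCovering-3-12 8 _ = removal-list-suffices 11 removed-throughout z<s refl
noCovering-3-12 9 _ = removal-list-suffices 12 removed-throughout z<s refl
noCovering-3-12 (suc (suc (suc (suc (suc (suc (suc (suc (suc (suc i)))))))))) (s≤s (s≤s (s≤s (s≤s (s≤s (s≤s (s≤s (s≤s (s≤s (s≤s ()))))))))))

trial-divisors : List ℕ
trial-divisors =
  2 ∷ 3 ∷ 5 ∷ 7 ∷ 11 ∷ 13 ∷ 17 ∷ 19 ∷ 23 ∷ 29 ∷ 31 ∷ 37 ∷ 41 ∷ 43 ∷ 47 ∷ 53 ∷ 59 ∷ 61 ∷ 67 ∷ 71 ∷ 73 ∷ 79 ∷ 83 ∷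
  89 ∷ 97 ∷ 101 ∷ 103 ∷ 107 ∷ 109 ∷ 113 ∷ 127 ∷ 131 ∷ 137 ∷ 139 ∷ 149 ∷ 151 ∷ 157 ∷ 163 ∷ 167 ∷ 173 ∷ 179 ∷ 181 ∷
  191 ∷ 193 ∷ 197 ∷ 199 ∷ 211 ∷ 223 ∷ 227 ∷ 229 ∷ 233 ∷ 239 ∷ 241 ∷ 251 ∷ 257 ∷ 263 ∷ 269 ∷ 271 ∷ 277 ∷ 281 ∷ 283 ∷
  293 ∷ 307 ∷ 311 ∷ 313 ∷ 317 ∷ 331 ∷ 337 ∷ 347 ∷ 349 ∷ 353 ∷ 359 ∷ 367 ∷ 373 ∷ 379 ∷ 383 ∷ 389 ∷ 397 ∷ 401 ∷ 409 ∷
  419 ∷ 421 ∷ 431 ∷ 433 ∷ 439 ∷ 443 ∷ 449 ∷ 457 ∷ 461 ∷ 463 ∷ 467 ∷ 479 ∷ 487 ∷ 491 ∷ 499 ∷ 503 ∷ 509 ∷ 521 ∷ 523 ∷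
  541 ∷ 547 ∷ 557 ∷ 563 ∷ 569 ∷ 571 ∷ 577 ∷ 587 ∷ 593 ∷ 599 ∷ 601 ∷ 607 ∷ 613 ∷ 617 ∷ 619 ∷ 631 ∷ 641 ∷ 643 ∷ 647 ∷
  653 ∷ 659 ∷ 661 ∷ 673 ∷ 677 ∷ 683 ∷ 691 ∷ 701 ∷ 709 ∷ 719 ∷ 727 ∷ []

-- Only one direction is ever needed: every prime passes. A composite that passed would enlarge the
-- lists of candidates and thereby only the upper bounds computed from them.
passes : List ℕ → ℕ → Bool
passes (suc (suc q) ∷ qs) m =
  if m <ᵇ (2 + q) * (2 + q) then true else (if m % (2 + q) ≡ᵇ 0 then false else passes qs m)
passes _ m = true

prime-passes : ∀ qs {m} → Prime m → passes qs m ≡ true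
prime-passes []             pr = refl
prime-passes (0 ∷ qs)       pr = refl
prime-passes (1 ∷ qs)       pr = refl
prime-passes (suc (suc q) ∷ qs) {m} pr with m <ᵇ (2 + q) * (2 + q) in eq
... | true  = refl
... | false with m % (2 + q) in eq′
... | suc _ = prime-passes qs pr
... | zero  with prime⇒irreducible pr (m%n≡0⇒n∣m m (2 + q) eq′)
... | inj₁ ()
... | inj₂ refl = contradiction (subst T eq (<⇒<ᵇ (m<m*n (2 + q) (2 + q) (s≤s z<s)))) λ ()

select : (ℕ → Bool) → ℕ → ℕ → List ℕ
select t lo zero    = []
select t lo (suc k) = if t lo then lo ∷ select t (suc lo) k else select t (suc lo) k

select-∈ : ∀ t lo k {m} → lo ≤ m → m < lo + k → t m ≡ true → m ∈ select t lo k
select-∈ t lo zero    {m} l u _  = contradiction (subst (m <_) (+-identityʳ lo) u) (≤⇒≯ l)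
select-∈ t lo (suc k) {m} l u tm with lo ≟ m
... | yes refl rewrite tm = here refl
... | no lo≢m with t lo
... | true  = there (select-∈ t (suc lo) k (≤∧≢⇒< l lo≢m) (subst (m <_) (+-suc lo k) u) tm)
... | false = select-∈ t (suc lo) k (≤∧≢⇒< l lo≢m) (subst (m <_) (+-suc lo k) u) tm

select-≥ : ∀ t lo k → All (lo ≤_) (select t lo k)
select-≥ t lo zero    = []
select-≥ t lo (suc k) with t lo
... | true  = ≤-refl ∷ All.map <⇒≤ (select-≥ t (suc lo) k)
... | false = All.map <⇒≤ (select-≥ t (suc lo) k)

select-< : ∀ t lo k → All (_< lo + k) (select t lo k)
select-< t lo zero    = []
select-< t lo (suc k) with t lo
... | true  = m<m+n lo z<s ∷ subst (λ z → All (_< z) (select t (suc lo) k)) (sym (+-suc lo k)) (select-< t (suc lo) k)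
... | false = subst (λ z → All (_< z) (select t (suc lo) k)) (sym (+-suc lo k)) (select-< t (suc lo) k)

select-sorted : ∀ t lo k → AllPairs _≤_ (select t lo k)
select-sorted t lo zero    = []
select-sorted t lo (suc k) with t lo
... | true  = All.map <⇒≤ (select-≥ t (suc lo) k) ∷ select-sorted t (suc lo) k
... | false = select-sorted t (suc lo) k

candidates : ℕ → ℕ → List ℕ
candidates = select (passes trial-divisors)

candidates-∈ : ∀ lo k {p} → lo ≤ p → p < lo + k → Prime p → p ∈ candidates lo k
candidates-∈ lo k l u pr = select-∈ _ lo k l u (prime-passes trial-divisors pr)

prime⇒2≤ : ∀ {p} → Prime p → 2 ≤ p
prime⇒2≤ {p} pr = nonTrivial⇒n>1 p {{prime⇒nonTrivial pr}}

-- 2000 exceeds the depth of every enumeration tree below; a smaller value would only weaken the bound.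
smooth-light : ℕ → ℕ → ℕ → Bool
smooth-light a k y = Enumeration.enumerate a k 1000000000 2000 (candidates 2 (y ∸ 1)) 1 <ᵇ 1000000000

batch : ℕ → ℕ → ℕ → Bool
batch a b y = (5 * b <ᵇ y * suc y) ∧ smooth-light a (suc (6 * b) ∸ a) y

batch-correct : ∀ {a b y n} → 0 < a → a ≤ n → n ≤ b → batch a b y ≡ true → NoCovering n
batch-correct {a} {b} {y} {n} 0<a a≤n n≤b ok cs dc inn = <⇒≱ (<ᵇ-true (proj₂ (∧-true {5 * b <ᵇ y * suc y} ok))) (begin
  Q
    ≤⟨ reciprocal-sum (noPrimeIn? y (6 * b)) (remove-large-primes y y-big (6 * b)) 0<n Q (recip Q)
         (λ m l → recip-big Q (≤-trans 0<n l)) ⟩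
  ∑ n (suc (5 * n)) f
    ≤⟨ ∑-⊆ f a≤n (≤-trans (≤-reflexive (window-end n)) (≤-trans (s≤s (*-monoʳ-≤ 6 n≤b)) (≤-reflexive (sym end)))) ⟩
  ∑ a k f
    ≤⟨ ∑-enumerate 0<a 2000 (candidates 2 (y ∸ 1)) 1 z<s (select-sorted _ 2 (y ∸ 1)) f (λ m → ι-≤ (noPrimeIn? y (6 * b) m) _) supp ⟩
  enumerate 2000 (candidates 2 (y ∸ 1)) 1 ∎)
  where
  open ≤-Reasoning
  open Moduli n cs dc inn
  Q = 1000000000
  k = suc (6 * b) ∸ a
  open Enumeration a k Q
  0<n : 0 < n
  0<n = ≤-trans 0<a a≤n
  y-big : suc (5 * n) ≤ y * suc y
  y-big = ≤-trans (s≤s (*-monoʳ-≤ 5 n≤b)) (<ᵇ-true (proj₁ (∧-true ok)))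
  end : a + k ≡ suc (6 * b)
  end = m+[n∸m]≡n (≤-trans (≤-trans a≤n n≤b) (≤-trans (m≤m+n b (5 * b)) (n≤1+n (6 * b))))
  f : ℕ → ℕ
  f m = ι (noPrimeIn? y (6 * b) m) (recip Q m)
  supp : ∀ m → a ≤ m → m < a + k → f m ≢ 0 → m ProductOf 1 · candidates 2 (y ∸ 1)
  supp m l u nz with noPrimeIn? y (6 * b) m
  ... | no _   = contradiction refl nz
  ... | yes np = m , sym (*-identityˡ m) , λ pr p∣m → candidates-∈ 2 (y ∸ 1) (prime⇒2≤ pr)
    (s≤s (≤-trans (noPrimeIn⇒smooth y (6 * b) (≤-trans 0<a l)
       (≤-trans (s≤s⁻¹ (subst (m <_) end u)) (m≤n+m (6 * b) y)) np pr p∣m) (m≤n+m∸n y 1))) pr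

batches : ℕ → List (ℕ × ℕ) → Bool
batches a []             = true
batches a ((b , y) ∷ bs) = batch a b y ∧ batches (suc b) bs

batches-end : ℕ → List (ℕ × ℕ) → ℕ
batches-end a []             = a
batches-end a ((b , y) ∷ bs) = batches-end (suc b) bs

batches-correct : ∀ a bs {n} → 0 < a → batches a bs ≡ true → a ≤ n → n < batches-end a bs → NoCovering n
batches-correct a []             0<a ok a≤n n<e = contradiction n<e (≤⇒≯ a≤n)
batches-correct a ((b , y) ∷ bs) {n} 0<a ok a≤n n<e with ∧-true {batch a b y} ok | n ≤? b
... | ok₁ , _   | yes n≤b = batch-correct {a} {b} {y} 0<a a≤n n≤b ok₁
... | _   , ok₂ | no n≰b  = batches-correct (suc b) bs z<s ok₂ (≰⇒> n≰b) n<e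

-- Each `y` is the least with `5 * b < y * suc y`. The enlarged window `[a , 6b]` costs more the
-- further `b` is from `a`; from `a = 1362` on, `b = 2 * a` is affordable.
medium-batches : List (ℕ × ℕ)
medium-batches =
  (18 , 10) ∷ (24 , 11) ∷ (31 , 12) ∷ (51 , 16) ∷ (70 , 19) ∷ (107 , 23) ∷ (185 , 30) ∷ (346 , 42) ∷ (684 , 58) ∷
  (1361 , 82) ∷ (2724 , 117) ∷ (5450 , 165) ∷ (10902 , 233) ∷ (21806 , 330) ∷ (43614 , 467) ∷ (87230 , 660) ∷
  (174462 , 934) ∷ (348926 , 1321) ∷ []

noCovering-13-348926 : ∀ n → 13 ≤ n → n < 348927 → NoCovering n
noCovering-13-348926 n = batches-correct 13 medium-batches z<s refl

-- Harmonic sums over the window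

*≤⇒≤÷ : ∀ {a m c} → 0 < m → a * m ≤ c → a ≤ c ÷ m
*≤⇒≤÷ {a} {suc m} {c} _ h = subst (_≤ c / suc m) (m*n/n≡m a (suc m)) (/-monoˡ-≤ (suc m) h)

÷-monoʳ : ∀ x {i j} → 0 < i → i ≤ j → x ÷ j ≤ x ÷ i
÷-monoʳ x {i} {j} 0<i i≤j = *≤⇒≤÷ 0<i (≤-trans (*-monoʳ-≤ (x ÷ j) i≤j) (÷-*-≤ x j))

÷-÷ : ∀ c d j → 0 < d → 0 < j → c ÷ (d * j) ≡ c ÷ d ÷ j
÷-÷ c (suc d) (suc j) _ _ = sym (m/n/o≡m/[n*o] c (suc d) (suc j))

harmonic : ℕ → ℕ → ℕ
harmonic x a = ∑[ j from a for suc (5 * a) ] (x ÷ j)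

-- Passing from `a` to `suc a` loses the term `x ÷ a` and gains the six terms at `6a + 1` to
-- `6a + 6`, each at most a sixth of it.
harmonic-suc : ∀ x a → 0 < a → harmonic x (suc a) ≤ harmonic x a
harmonic-suc x a 0<a = begin
  ∑ (suc a) (suc (5 * suc a)) f                         ≡⟨ cong (λ z → ∑ (suc a) z f) (len a) ⟩
  ∑ (suc a) (5 * a + 6) f                               ≡⟨ ∑-split (suc a) (5 * a) 6 f ⟩
  ∑ (suc a) (5 * a) f + ∑ (suc a + 5 * a) 6 f           ≤⟨ +-monoʳ-≤ (∑ (suc a) (5 * a) f) last-six ⟩
  ∑ (suc a) (5 * a) f + f a                             ≡⟨ +-comm _ (f a) ⟩
  f a + ∑ (suc a) (5 * a) f                             ∎
  where
  open ≤-Reasoning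
  f : ℕ → ℕ
  f j = x ÷ j
  len : ∀ a → suc (5 * suc a) ≡ 5 * a + 6
  len = solve-∀
  last-six : ∑ (suc a + 5 * a) 6 f ≤ f a
  last-six = begin
    ∑ (suc a + 5 * a) 6 f                          ≤⟨ ∑-mono (suc a + 5 * a) 6 (λ j l _ →
      subst (f j ≤_) (÷-÷ x a 6 0<a z<s) (÷-monoʳ x (*-mono-< 0<a z<s)
        (≤-trans (≤-reflexive (*-comm a 6)) (≤-trans (n≤1+n _) l)))) ⟩
    ∑[ _ from suc a + 5 * a for 6 ] (x ÷ a ÷ 6)    ≡⟨ six (x ÷ a ÷ 6) ⟩
    x ÷ a ÷ 6 * 6                                  ≤⟨ ÷-*-≤ (x ÷ a) 6 ⟩
    x ÷ a                                          ∎
    where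
    six : ∀ z → z + (z + (z + (z + (z + (z + 0))))) ≡ z * 6
    six = solve-∀

harmonic-antitone : ∀ x {a b} → 0 < a → a ≤ b → harmonic x b ≤ harmonic x a
harmonic-antitone x {a} {b} 0<a a≤b = subst (λ z → harmonic x z ≤ harmonic x a) (m∸n+n≡m a≤b) (go (b ∸ a))
  where
  go : ∀ t → harmonic x (t + a) ≤ harmonic x a
  go zero    = ≤-refl
  go (suc t) = ≤-trans (harmonic-suc x (t + a) (≤-trans 0<a (m≤n+m a t))) (go t)

∑-multiples-block : ∀ d b (f : ℕ → ℕ) → ∑[ m from suc (d * b) for d ] ι (d ∣? m) (f m) ≤ f (d * suc b)
∑-multiples-block d b f = begin
  ∑[ m from suc (d * b) for d ] ι (d ∣? m) (f m)                       ≤⟨ ∑-mono (suc (d * b)) d at ⟩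
  ∑[ m from suc (d * b) for d ] (f (d * suc b) * ι (d ∣? m) 1)         ≡⟨ ∑-* (suc (d * b)) d (f (d * suc b)) _ ⟩
  f (d * suc b) * ∑[ m from suc (d * b) for d ] ι (d ∣? m) 1           ≤⟨ *-monoʳ-≤ (f (d * suc b))
                                                                            (separated-short (λ m → d ∣? m) d ∣⇒∣∸ (suc (d * b)) d ≤-refl) ⟩
  f (d * suc b) * 1                                                    ≡⟨ *-identityʳ _ ⟩
  f (d * suc b)                                                        ∎
  where
  open ≤-Reasoning
  at : ∀ m → suc (d * b) ≤ m → m < suc (d * b) + d → ι (d ∣? m) (f m) ≤ f (d * suc b) * ι (d ∣? m) 1
  at m l u with d ∣? m
  ... | no _ = z≤n
  ... | yes (divides q refl) = ≤-reflexive (trans (cong f (trans (cong (_* d) q≡1+b) (*-comm (suc b) d))) (sym (*-identityʳ _)))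
    where
    q≡1+b : q ≡ suc b
    q≡1+b = ≤-antisym
      (*-cancelˡ-≤ d {{≢-nonZero λ { refl → <⇒≱ l (≤-trans (≤-reflexive (*-zeroʳ q)) z≤n) }}} (begin
        d * q          ≡⟨ *-comm d q ⟩
        q * d          ≤⟨ s≤s⁻¹ u ⟩
        d * b + d      ≡⟨ trans (+-comm (d * b) d) (sym (*-suc d b)) ⟩
        d * suc b      ∎))
      (*-cancelˡ-< d b q (subst (d * b <_) (*-comm q d) l))

∑-multiples : ∀ d b L (f : ℕ → ℕ) →
              ∑[ m from suc (d * b) for L * d ] ι (d ∣? m) (f m) ≤ ∑[ j from suc b for L ] f (d * j)
∑-multiples d b zero    f = z≤n
∑-multiples d b (suc L) f = begin
  ∑ (suc (d * b)) (d + L * d) g                               ≡⟨ ∑-split (suc (d * b)) d (L * d) g ⟩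
  ∑ (suc (d * b)) d g + ∑ (suc (d * b) + d) (L * d) g         ≡⟨ cong (λ z → ∑ (suc (d * b)) d g + ∑ (suc z) (L * d) g)
                                                                   (trans (+-comm (d * b) d) (sym (*-suc d b))) ⟩
  ∑ (suc (d * b)) d g + ∑ (suc (d * suc b)) (L * d) g         ≤⟨ +-mono-≤ (∑-multiples-block d b f) (∑-multiples d (suc b) L f) ⟩
  f (d * suc b) + ∑[ j from suc (suc b) for L ] f (d * j)     ∎
  where
  open ≤-Reasoning
  g : ℕ → ℕ
  g m = ι (d ∣? m) (f m)

-- C times the sum of 1 / m over the multiples m of d in [n , 6n], when C is a multiple of them all
multiplesSum : ℕ → ℕ → ℕ → ℕ
multiplesSum n C d = ∑[ m from n for suc (5 * n) ] ι (d ∣? m) (C ÷ m)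

-- The multiples of `d` in the window are among the `d * j` with `a ≤ j ≤ 6a`, where `a` is `n / d`
-- rounded up. Since `A * d < n` forces `a > A`, antitonicity replaces `a` by `suc A`, and the
-- remaining harmonic range depends on neither `n` nor `d`.
multiplesSum-≤-harmonic : ∀ n C d A → 0 < d → 0 < n → A * d < n → multiplesSum n C d ≤ harmonic (C ÷ d) (suc A)
multiplesSum-≤-harmonic (suc n) C d A 0<d _ Ad<n = begin
  multiplesSum (suc n) C d                                             ≤⟨ ∑-⊆ {lo = suc n} {k = suc (5 * suc n)} g (s≤s db≤n) end ⟩
  ∑ (suc (d * b)) (suc (5 * a) * d) g                                  ≤⟨ ∑-multiples d b (suc (5 * a)) (C ÷_) ⟩
  ∑[ j from a for suc (5 * a) ] (C ÷ (d * j))                          ≤⟨ ∑-mono a (suc (5 * a)) (λ j l _ →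
                                                                            ≤-reflexive (÷-÷ C d j 0<d (≤-trans z<s l))) ⟩
  harmonic (C ÷ d) a                                                   ≤⟨ harmonic-antitone (C ÷ d) z<s (s≤s (*≤⇒≤÷ 0<d (s≤s⁻¹ Ad<n))) ⟩
  harmonic (C ÷ d) (suc A)                                             ∎
  where
  open ≤-Reasoning
  -- The left end of the window is `suc n`, so `suc b` is the quotient `suc n / d` rounded up.
  b = n ÷ d
  a = suc b
  g : ℕ → ℕ
  g m = ι (d ∣? m) (C ÷ m)
  db≤n : d * b ≤ n
  db≤n = ≤-trans (≤-reflexive (*-comm d b)) (÷-*-≤ n d)
  end : suc n + suc (5 * suc n) ≤ suc (d * b) + suc (5 * a) * d
  end = begin
    suc n + suc (5 * suc n)         ≡⟨ window-end (suc n) ⟩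
    suc (6 * suc n)                 ≤⟨ s≤s (*-monoʳ-≤ 6 (<-*-suc÷ n 0<d)) ⟩
    suc (6 * (suc b * d))           ≡⟨ eq d b ⟩
    suc (d * b) + suc (5 * a) * d   ∎
    where
    eq : ∀ d b → suc (6 * (suc b * d)) ≡ suc (d * b) + suc (5 * suc b) * d
    eq = solve-∀

scale-÷ : ∀ Q x {j} → 0 < j → Q * (x ÷ j) ≤ recip Q j * x
scale-÷ Q x {j} 0<j = begin
  Q * (x ÷ j)               ≤⟨ *-monoˡ-≤ (x ÷ j) (recip-big Q 0<j) ⟩
  recip Q j * j * (x ÷ j)   ≡⟨ rearr (recip Q j) j (x ÷ j) ⟩
  recip Q j * (x ÷ j * j)   ≤⟨ *-monoʳ-≤ (recip Q j) (÷-*-≤ x j) ⟩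
  recip Q j * x             ∎
  where
  open ≤-Reasoning
  rearr : ∀ a b c → a * b * c ≡ a * (c * b)
  rearr = solve-∀

harmonicBound : ℕ → ℕ → ℕ
harmonicBound Q a = ∑[ j from a for suc (5 * a) ] recip Q j

multiplesSum-≤ : ∀ Q n C d A → 0 < d → 0 < n → A * d < n →
                 Q * multiplesSum n C d ≤ harmonicBound Q (suc A) * (C ÷ d)
multiplesSum-≤ Q n C d A 0<d 0<n Ad<n = begin
  Q * multiplesSum n C d                                          ≤⟨ *-monoʳ-≤ Q (multiplesSum-≤-harmonic n C d A 0<d 0<n Ad<n) ⟩
  Q * harmonic x (suc A)                                          ≡⟨ sym (∑-* (suc A) L Q _) ⟩
  ∑[ j from suc A for L ] (Q * (x ÷ j))                           ≤⟨ ∑-mono (suc A) L (λ j l _ → ≤-trans (scale-÷ Q x (≤-trans z<s l))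
                                                                       (≤-reflexive (*-comm (recip Q j) x))) ⟩
  ∑[ j from suc A for L ] (x * recip Q j)                         ≡⟨ ∑-* (suc A) L x _ ⟩
  x * harmonicBound Q (suc A)                                     ≡⟨ *-comm x _ ⟩
  harmonicBound Q (suc A) * x                                     ∎
  where
  open ≤-Reasoning
  x = C ÷ d
  L = suc (5 * suc A)

-- Telescoping through `1 / (a + 1)² + 1 / (a + 1) ≤ 1 / a`.
∑-inverse-squares : ∀ C a L → 0 < a → ∑[ q from suc a for L ] (C ÷ (q * q)) ≤ C ÷ a
∑-inverse-squares C a zero    0<a = z≤n
∑-inverse-squares C a (suc L) 0<a = begin
  C ÷ (q * q) + ∑[ q from suc q for L ] (C ÷ (q * q))   ≤⟨ +-monoʳ-≤ (C ÷ (q * q)) (∑-inverse-squares C q L z<s) ⟩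
  C ÷ (q * q) + C ÷ q                                   ≤⟨ *≤⇒≤÷ 0<a (*-cancelʳ-≤ _ C (q * q) (begin
    (u + v) * a * (q * q)                               ≡⟨ expand u v a ⟩
    u * (q * q) * a + v * q * (a * q)                   ≤⟨ +-mono-≤ (*-monoˡ-≤ a (÷-*-≤ C (q * q))) (*-monoˡ-≤ (a * q) (÷-*-≤ C q)) ⟩
    C * a + C * (a * q)                                 ≤⟨ m≤m+n _ C ⟩
    C * a + C * (a * q) + C                             ≡⟨ collect C a ⟩
    C * (q * q)                                         ∎)) ⟩
  C ÷ a                                                 ∎
  where
  open ≤-Reasoning
  q = suc a
  u = C ÷ (q * q)
  v = C ÷ q
  expand : ∀ u v a → (u + v) * a * (suc a * suc a) ≡ u * (suc a * suc a) * a + v * suc a * (a * suc a)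
  expand = solve-∀
  collect : ∀ C a → C * a + C * (a * suc a) + C ≡ C * (suc a * suc a)
  collect = solve-∀

-- Logarithmic weights

^-distribʳ-* : ∀ k m n → (m * n) ^ k ≡ m ^ k * n ^ k
^-distribʳ-* zero    m n = refl
^-distribʳ-* (suc k) m n = trans (cong (m * n *_) (^-distribʳ-* k m n)) (rearr m n (m ^ k) (n ^ k))
  where
  rearr : ∀ a b c d → a * b * (c * d) ≡ a * c * (b * d)
  rearr = solve-∀

2^-cancel-≤ : ∀ {a b} → 2 ^ a ≤ 2 ^ b → a ≤ b
2^-cancel-≤ {a} {b} h with a ≤? b
... | yes p = p
... | no ¬p = contradiction h (<⇒≱ (^-monoʳ-< 2 (s≤s z<s) (≰⇒> ¬p)))

-- For prime `q` and positive `m` this is the exponent of `q` in `m`, truncated at `T`. As a sum of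
-- indicators of divisibility it can be exchanged with the sum over `m`.
powersDividing : ℕ → ℕ → ℕ → ℕ
powersDividing q T m = ∑[ j from 1 for T ] ι (q ^ j ∣? m) 1

module Weight (top : ℕ → ℕ) where

  weight : List (ℕ × ℕ) → ℕ → ℕ
  weight D m = ⅀[ e ∈ D ] (proj₂ e * powersDividing (proj₁ e) (top (proj₁ e)) m)

  Covered : List (ℕ × ℕ) → ℕ → ℕ → Set
  Covered D K m = ∀ {p} → Prime p → p ∣ m →
    (∃ λ w → (p , w) ∈ D × p ^ K ≤ 2 ^ w) × ¬ p ^ suc (top p) ∣ m

  private
    powersDividing-mono : ∀ q T {m m′} → m ∣ m′ → powersDividing q T m ≤ powersDividing q T m′
    powersDividing-mono q T {m} {m′} m∣m′ = ∑-mono′ 1 T λ j → ι-implies (q ^ j ∣? m) (q ^ j ∣? m′) 1 λ h → ∣-trans h m∣m′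

    ∑-shift : ∀ lo k (f : ℕ → ℕ) → ∑ (suc lo) k f ≡ ∑[ j from lo for k ] f (suc j)
    ∑-shift lo zero    f = refl
    ∑-shift lo (suc k) f = cong (f (suc lo) +_) (∑-shift (suc lo) k f)

    -- Each `p ^ j` dividing `m` yields `p ^ suc j` dividing `p * m`. The index `j = 0` always
    -- contributes and supplies the extra 1; the top index contributes nothing to `m` by hypothesis.
    powersDividing-suc : ∀ {p} → Prime p → ∀ T {m} → ¬ p ^ suc T ∣ p * m →
                         suc (powersDividing p T m) ≤ powersDividing p T (p * m)
    powersDividing-suc {p} pr zero    {m} h = contradiction (subst (_∣ p * m) (sym (*-identityʳ p)) (m∣m*n m)) h
    powersDividing-suc {p} pr (suc T) {m} h = begin
      suc (∑[ j from 1 for suc T ] ι (p ^ j ∣? m) 1)          ≡⟨ cong (λ z → suc (∑ 1 z g)) (+-comm 1 T) ⟩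
      suc (∑[ j from 1 for T + 1 ] ι (p ^ j ∣? m) 1)          ≡⟨ cong suc (∑-split 1 T 1 g) ⟩
      suc (∑ 1 T g + (ι (p ^ suc T ∣? m) 1 + 0))              ≡⟨ cong (λ z → suc (∑ 1 T g + (z + 0)))
                                                                  (ι-no (p ^ suc T ∣? m) 1 λ d → h (*-monoʳ-∣ p d)) ⟩
      suc (∑ 1 T g + 0)                                       ≡⟨ cong suc (+-identityʳ _) ⟩
      suc (∑ 1 T g)                                           ≡⟨ cong (_+ ∑ 1 T g) (sym (ι-yes (p ^ 0 ∣? m) 1 (1∣ m))) ⟩
      ∑[ j from 0 for suc T ] ι (p ^ j ∣? m) 1                ≤⟨ ∑-mono′ 0 (suc T) (λ j →
                                                                   ι-implies (p ^ j ∣? m) (p ^ suc j ∣? p * m) 1 (*-monoʳ-∣ p)) ⟩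
      ∑[ j from 0 for suc T ] ι (p ^ suc j ∣? p * m) 1        ≡⟨ sym (∑-shift 0 (suc T) _) ⟩
      ∑[ j from 1 for suc T ] ι (p ^ j ∣? p * m) 1            ∎
      where
      open ≤-Reasoning
      g : ℕ → ℕ
      g j = ι (p ^ j ∣? m) 1

    ⅀-gain : {A : Set} {xs : List A} {f g : A → ℕ} {a : A} (δ : ℕ) → (∀ x → f x ≤ g x) →
             a ∈ xs → f a + δ ≤ g a → ⅀ xs f + δ ≤ ⅀ xs g
    ⅀-gain {xs = x ∷ xs} {f} {g} δ f≤g (here refl) h = begin
      f x + ⅀ xs f + δ     ≡⟨ swap (f x) (⅀ xs f) δ ⟩
      f x + δ + ⅀ xs f     ≤⟨ +-mono-≤ h (⅀-mono xs λ y _ → f≤g y) ⟩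
      g x + ⅀ xs g         ∎
      where
      open ≤-Reasoning
      swap : ∀ a b c → a + b + c ≡ a + c + b
      swap = solve-∀
    ⅀-gain {xs = x ∷ xs} {f} {g} δ f≤g (there a∈) h = begin
      f x + ⅀ xs f + δ     ≡⟨ +-assoc (f x) _ δ ⟩
      f x + (⅀ xs f + δ)   ≤⟨ +-mono-≤ (f≤g x) (⅀-gain δ f≤g a∈ h) ⟩
      g x + ⅀ xs g         ∎
      where open ≤-Reasoning

  weight-gain : ∀ D {K p m} → Prime p → Covered D K (p * m) → p ^ K * 2 ^ weight D m ≤ 2 ^ weight D (p * m)
  weight-gain D {K} {p} {m} pr cov with cov pr (m∣m*n m)
  ... | (w , w∈ , p^K≤) , ∤ = begin
    p ^ K * 2 ^ weight D m       ≤⟨ *-monoˡ-≤ (2 ^ weight D m) p^K≤ ⟩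
    2 ^ w * 2 ^ weight D m       ≡⟨ sym (^-distribˡ-+-* 2 w (weight D m)) ⟩
    2 ^ (w + weight D m)         ≤⟨ ^-monoʳ-≤ 2 (≤-trans (≤-reflexive (+-comm w _)) gain) ⟩
    2 ^ weight D (p * m)         ∎
    where
    open ≤-Reasoning
    gain : weight D m + w ≤ weight D (p * m)
    gain = ⅀-gain w (λ e → *-monoʳ-≤ (proj₂ e) (powersDividing-mono (proj₁ e) (top (proj₁ e)) (n∣m*n p))) w∈
      (≤-trans (≤-reflexive (trans (+-comm _ w) (sym (*-suc w _)))) (*-monoʳ-≤ w (powersDividing-suc pr (top p) ∤)))

  -- Building `m` up one prime at a time, each factor `p` raises the weight by at least the `w`
  -- listed for `p`, because truncation at `top p` never takes effect for a divisor of `m`.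
  covered-weight : ∀ D {K m} → 0 < m → Covered D K m → m ^ K ≤ 2 ^ weight D m
  covered-weight D {K} {m} 0<m cov with factorise m {{>-nonZero 0<m}}
  ... | record { factors = ps ; isFactorisation = refl ; factorsPrime = prs } = go ps prs cov
    where
    go : ∀ ps → All Prime ps → Covered D K (product ps) → product ps ^ K ≤ 2 ^ weight D (product ps)
    go []       _          _   = ≤-trans (≤-reflexive (^-zeroˡ K)) (m^n>0 2 (weight D 1))
    go (p ∷ ps) (pr ∷ prs) cov = begin
      (p * product ps) ^ K                 ≡⟨ ^-distribʳ-* K p (product ps) ⟩
      p ^ K * product ps ^ K               ≤⟨ *-monoʳ-≤ (p ^ K) (go ps prs λ pr′ q∣ →
                                                 let a , b = cov pr′ (∣n⇒∣m*n p q∣) in a , λ d → b (∣n⇒∣m*n p d)) ⟩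
      p ^ K * 2 ^ weight D (product ps)    ≤⟨ weight-gain D {K} pr cov ⟩
      2 ^ weight D (p * product ps)        ∎
      where open ≤-Reasoning

  -- `G` stands for `K log₂ n` rounded down. A smooth `m` in the window either has weight at least
  -- `G` or is a multiple of some `e` in `E`; so `G` times its reciprocal is paid by its weight or
  -- by the excluded sum. `B / Q` and `Δ / Q` bound the two totals.
  weight-criterion : ∀ n y (D : List (ℕ × ℕ)) (E : List ℕ) K G Q B Δ →
    0 < n → suc (5 * n) ≤ y * suc y →
    (∀ {m} → Smooth y m → (∀ {e} → e ∈ E → ¬ e ∣ m) → Covered D K m) →
    2 ^ G ≤ n ^ K →
    (∀ C → Q * ⅀[ e ∈ D ] (proj₂ e * ∑[ j from 1 for top (proj₁ e) ] multiplesSum n C (proj₁ e ^ j)) ≤ B * C) →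
    (∀ C → Q * ⅀[ e ∈ E ] multiplesSum n C e ≤ Δ * C) →
    B + G * Δ < G * Q → NoCovering n
  weight-criterion n y D E K G Q B Δ 0<n y-big covered G≤ D-sum E-sum small cs dc inn =
    <⇒≱ small (*-cancelʳ-≤ (G * Q) (B + G * Δ) C {{(6 * n) !≢0}} (begin
      G * Q * C                         ≡⟨ rearr₁ G Q C ⟩
      Q * (G * C)                       ≤⟨ *-monoʳ-≤ Q total ⟩
      Q * (SD + G * SE)                 ≡⟨ rearr₂ Q SD G SE ⟩
      Q * SD + G * (Q * SE)             ≤⟨ +-mono-≤ (D-sum C) (*-monoʳ-≤ G (E-sum C)) ⟩
      B * C + G * (Δ * C)               ≡⟨ rearr₃ B C G Δ ⟩
      (B + G * Δ) * C                   ∎))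
    where
    open ≤-Reasoning
    open Moduli n cs dc inn
    rearr₁ : ∀ G Q C → G * Q * C ≡ Q * (G * C)
    rearr₁ = solve-∀
    rearr₂ : ∀ Q a G b → Q * (a + G * b) ≡ Q * a + G * (Q * b)
    rearr₂ = solve-∀
    rearr₃ : ∀ B C G Δ → B * C + G * (Δ * C) ≡ (B + G * Δ) * C
    rearr₃ = solve-∀
    C = (6 * n) !
    L = suc (5 * n)
    P? = noPrimeIn? y (6 * n)
    SD SE : ℕ
    SD = ⅀[ e ∈ D ] (proj₂ e * ∑[ j from 1 for top (proj₁ e) ] multiplesSum n C (proj₁ e ^ j))
    SE = ⅀[ e ∈ E ] multiplesSum n C e
    excluded : ℕ → ℕ
    excluded m = ⅀[ e ∈ E ] ι (e ∣? m) (C ÷ m)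

    pointwise : ∀ m → n ≤ m → m < n + L → G * ι (P? m) (C ÷ m) ≤ weight D m * (C ÷ m) + G * excluded m
    pointwise m l u with P? m
    ... | no _   = ≤-trans (≤-reflexive (*-zeroʳ G)) z≤n
    ... | yes np with Any.any? (_∣? m) E
    ... | yes hit = ≤-trans (*-monoʳ-≤ G (one hit)) (m≤n+m _ _)
      where
      one : ∀ {E} → Any (_∣ m) E → C ÷ m ≤ ⅀[ e ∈ E ] ι (e ∣? m) (C ÷ m)
      one (here {e} e∣m) = ≤-trans (≤-reflexive (sym (ι-yes (e ∣? m) (C ÷ m) e∣m))) (m≤m+n _ _)
      one (there h)      = ≤-trans (one h) (m≤n+m _ _)
    ... | no ¬hit = ≤-trans (*-monoˡ-≤ (C ÷ m) G≤W) (m≤m+n _ _)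
      where
      0<m : 0 < m
      0<m = ≤-trans 0<n l
      smooth : Smooth y m
      smooth = noPrimeIn⇒smooth y (6 * n) 0<m (≤-trans (s≤s⁻¹ (subst (m <_) (window-end n) u)) (m≤n+m _ y)) np
      2^G≤2^W : 2 ^ G ≤ 2 ^ weight D m
      2^G≤2^W = ≤-trans G≤ (≤-trans (^-monoˡ-≤ K l)
        (covered-weight D {K} 0<m (covered smooth λ e∈ e∣m → ¬hit (Any.map (λ { refl → e∣m }) e∈))))
      G≤W : G ≤ weight D m
      G≤W = 2^-cancel-≤ 2^G≤2^W

    weight-sum : ∑[ m from n for L ] (weight D m * (C ÷ m)) ≡ SD
    weight-sum = begin-equality
      ∑[ m from n for L ] (weight D m * (C ÷ m))
        ≡⟨ ∑-cong n L (λ m → trans (*-comm (weight D m) (C ÷ m)) (sym (⅀-* D (C ÷ m) _))) ⟩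
      ∑[ m from n for L ] (⅀[ e ∈ D ] ((C ÷ m) * (proj₂ e * powersDividing (proj₁ e) (top (proj₁ e)) m)))
        ≡⟨ ∑-⅀-swap n L D _ ⟩
      ⅀[ e ∈ D ] (∑[ m from n for L ] ((C ÷ m) * (proj₂ e * powersDividing (proj₁ e) (top (proj₁ e)) m)))
        ≡⟨ ⅀-cong D (λ { (q , w) → per-prime q w }) ⟩
      SD ∎
      where
      per-prime : ∀ q w → ∑[ m from n for L ] ((C ÷ m) * (w * powersDividing q (top q) m)) ≡
                          w * ∑[ j from 1 for top q ] multiplesSum n C (q ^ j)
      per-prime q w = begin-equality
        ∑[ m from n for L ] ((C ÷ m) * (w * powersDividing q (top q) m))
          ≡⟨ ∑-cong n L (λ m → trans (comm₃ (C ÷ m) w (powersDividing q (top q) m))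
               (cong (w *_) (trans (sym (∑-* 1 (top q) (C ÷ m) _)) (∑-cong 1 (top q) λ j →
                 trans (ι-* (q ^ j ∣? m) (C ÷ m) 1) (cong (ι (q ^ j ∣? m)) (*-identityʳ (C ÷ m))))))) ⟩
        ∑[ m from n for L ] (w * ∑[ j from 1 for top q ] ι (q ^ j ∣? m) (C ÷ m))
          ≡⟨ ∑-* n L w _ ⟩
        w * ∑[ m from n for L ] (∑[ j from 1 for top q ] ι (q ^ j ∣? m) (C ÷ m))
          ≡⟨ cong (w *_) (∑-∑-swap n L 1 (top q) _) ⟩
        w * ∑[ j from 1 for top q ] multiplesSum n C (q ^ j) ∎
        where
        comm₃ : ∀ a b c → a * (b * c) ≡ b * (a * c)
        comm₃ = solve-∀

    total : G * C ≤ SD + G * SE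
    total = begin
      G * C
        ≤⟨ *-monoʳ-≤ G (union-bound P? (remove-large-primes y y-big (6 * n)) 0<n C (window-divides 0<n)) ⟩
      G * ∑[ m from n for L ] ι (P? m) (C ÷ m)
        ≡⟨ sym (∑-* n L G _) ⟩
      ∑[ m from n for L ] (G * ι (P? m) (C ÷ m))
        ≤⟨ ∑-mono n L pointwise ⟩
      ∑[ m from n for L ] (weight D m * (C ÷ m) + G * excluded m)
        ≡⟨ ∑-+ n L (λ m → weight D m * (C ÷ m)) (λ m → G * excluded m) ⟩
      ∑[ m from n for L ] (weight D m * (C ÷ m)) + ∑[ m from n for L ] (G * excluded m)
        ≡⟨ cong₂ _+_ weight-sum (trans (∑-* n L G excluded) (cong (G *_) (∑-⅀-swap n L E _))) ⟩
      SD + G * SE ∎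

-- Rounded binary logarithms

climb : ℕ → ℕ → ℕ → ℕ → ℕ
climb zero       x acc g = g
climb (suc fuel) x acc g = if acc <ᵇ x then climb fuel x (2 * acc) (suc g) else g

-- The binary logarithm rounded up, with value 0 at 0. The fuel `x` suffices because `x < 2 ^ x`.
clog : ℕ → ℕ
clog x = climb x x 1 0

climb-upper : ∀ fuel x g → x ≤ 2 ^ (g + fuel) → x ≤ 2 ^ climb fuel x (2 ^ g) g
climb-upper zero       x g h = subst (λ z → x ≤ 2 ^ z) (+-identityʳ g) h
climb-upper (suc fuel) x g h with 2 ^ g <ᵇ x in eq
... | true  = climb-upper fuel x (suc g) (subst (λ z → x ≤ 2 ^ z) (+-suc g fuel) h)
... | false = ≮⇒≥ λ l → subst T eq (<⇒<ᵇ l)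

climb-lower : ∀ fuel x g → 2 ^ g < 2 * x → 2 ^ climb fuel x (2 ^ g) g < 2 * x
climb-lower zero       x g h = h
climb-lower (suc fuel) x g h with 2 ^ g <ᵇ x in eq
... | true  = climb-lower fuel x (suc g) (*-monoʳ-< 2 (<ᵇ-true {2 ^ g} {x} eq))
... | false = h

n<2^n : ∀ n → n < 2 ^ n
n<2^n zero    = s≤s z≤n
n<2^n (suc n) = begin-strict
  suc n            <⟨ s≤s (n<2^n n) ⟩
  1 + 2 ^ n        ≤⟨ +-monoˡ-≤ (2 ^ n) (m^n>0 2 n) ⟩
  2 ^ n + 2 ^ n    ≡⟨ cong (2 ^ n +_) (sym (+-identityʳ (2 ^ n))) ⟩
  2 ^ suc n        ∎
  where open ≤-Reasoning

≤2^clog : ∀ x → x ≤ 2 ^ clog x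
≤2^clog x = climb-upper x x 0 (<⇒≤ (n<2^n x))

2^clog< : ∀ {x} → 0 < x → 2 ^ clog x < 2 * x
2^clog< {x} 0<x = climb-lower x x 0 (*-monoʳ-≤ 2 0<x)

-- A lower bound for `log₂ (a / b)`: one subtracts 1 to pass from a ceiling to an exponent below
-- `log₂ a`, and then the ceiling for `b`. For positive arguments less than 2 is lost, negligible
-- against `K log₂ n`; truncation at 0 is harmless when `b ≤ a`.
flogQuotient : ℕ → ℕ → ℕ
flogQuotient a b = clog a ∸ 1 ∸ clog b

flogQuotient-≤ : ∀ {a b} → 0 < a → b ≤ a → 2 ^ flogQuotient a b * b ≤ a
flogQuotient-≤ {a} {b} 0<a b≤a with clog a | ≤2^clog b | 2^clog< 0<a
... | zero  | _  | _ = subst (_≤ a) (sym (trans (cong (λ z → 2 ^ z * b) (0∸n≡0 (clog b))) (*-identityˡ b))) b≤a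
... | suc s | hb | ha with clog b ≤? s
... | no c≰s  = subst (_≤ a) (sym (trans (cong (λ z → 2 ^ z * b) (m≤n⇒m∸n≡0 (<⇒≤ (≰⇒> c≰s)))) (*-identityˡ b))) b≤a
... | yes c≤s = begin
  2 ^ (s ∸ clog b) * b               ≤⟨ *-monoʳ-≤ (2 ^ (s ∸ clog b)) hb ⟩
  2 ^ (s ∸ clog b) * 2 ^ clog b      ≡⟨ sym (^-distribˡ-+-* 2 (s ∸ clog b) (clog b)) ⟩
  2 ^ (s ∸ clog b + clog b)          ≡⟨ cong (2 ^_) (m∸n+n≡m c≤s) ⟩
  2 ^ s                              ≤⟨ <⇒≤ (*-cancelˡ-< 2 (2 ^ s) a ha) ⟩
  a                                  ∎
  where open ≤-Reasoning

-- Prime powers carrying weight, and the excluded ones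

-- For q ≤ 100 the largest exponent with q ^ top q ≤ 10000.
top : ℕ → ℕ
top q = if q <ᵇ 3 then 13 else if q <ᵇ 4 then 8 else if q <ᵇ 6 then 5 else if q <ᵇ 8 then 4 else
        if q <ᵇ 22 then 3 else if q <ᵇ 101 then 2 else 1

top-large : ∀ {q} → 101 ≤ q → top q ≡ 1
top-large {q} l = trans (skip 3 13 (≤ᵇ⇒≤ 3 101 tt)) (trans (skip 4 8 (≤ᵇ⇒≤ 4 101 tt)) (trans (skip 6 5 (≤ᵇ⇒≤ 6 101 tt))
  (trans (skip 8 4 (≤ᵇ⇒≤ 8 101 tt)) (trans (skip 22 3 (≤ᵇ⇒≤ 22 101 tt)) (skip 101 2 ≤-refl)))))
  where
  skip : ∀ b T {r : ℕ} → b ≤ 101 → (if q <ᵇ b then T else r) ≡ r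
  skip b T b≤ with q <ᵇ b in eq
  ... | false = refl
  ... | true  = contradiction (<ᵇ-true {q} eq) (≤⇒≯ (≤-trans b≤ l))

top-power : ∀ q j → 2 ≤ j → j ≤ top q → q ^ j ≤ 10000
top-power q j 2≤j = cut 2 13 (≤ᵇ⇒≤ (2 ^ 13) 10000 tt) (cut 3 8 (≤ᵇ⇒≤ (3 ^ 8) 10000 tt) (cut 5 5 (≤ᵇ⇒≤ (5 ^ 5) 10000 tt)
  (cut 7 4 (≤ᵇ⇒≤ (7 ^ 4) 10000 tt) (cut 21 3 (≤ᵇ⇒≤ (21 ^ 3) 10000 tt) (cut 100 2 (≤ᵇ⇒≤ (100 ^ 2) 10000 tt)
  (λ j≤1 → contradiction 2≤j (<⇒≱ (s≤s j≤1))))))))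
  where
  cut : ∀ b T {r} .{{_ : NonZero b}} → b ^ T ≤ 10000 → (j ≤ r → q ^ j ≤ 10000) →
        j ≤ (if q <ᵇ suc b then T else r) → q ^ j ≤ 10000
  cut b T h rest with q <ᵇ suc b in eq
  ... | false = rest
  ... | true  = λ j≤T → ≤-trans (^-monoˡ-≤ j (s≤s⁻¹ (<ᵇ-true {q} eq))) (≤-trans (^-monoʳ-≤ b j≤T) h)

module Stage (S : ℕ) (top : ℕ → ℕ)
             (top-large : ∀ {q} → 101 ≤ q → top q ≡ 1)
             (top-power : ∀ q j → 2 ≤ j → j ≤ top q → q ^ j ≤ 10000)
             (smalls : List ℕ) (smalls≥2 : All (2 ≤_) smalls) (smalls∈ : ∀ {p} → Prime p → p ≤ 1000 → p ∈ smalls) where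

  open Weight top

  -- Above 1000 the squares of all integers are listed, not just of primes, so that their
  -- reciprocals telescope to at most `1 / 1000`. Below, the sum over the given short list is
  -- computed.
  excludedPowers : ℕ → List ℕ
  excludedPowers y = map (λ q → q ^ suc (top q)) (smalls) ++ map (λ q → q * q) (select (λ _ → true) 1001 (y ∸ 1000))

  excludedBound : ℕ
  excludedBound = harmonicBound S 1 * (⅀[ q ∈ smalls ] recip S (q ^ suc (top q)) + recip S 1000)

  ⅀-select-all : ∀ lo k (f : ℕ → ℕ) → ⅀ (select (λ _ → true) lo k) f ≡ ∑ lo k f
  ⅀-select-all lo zero    f = refl
  ⅀-select-all lo (suc k) f = cong (f lo +_) (⅀-select-all (suc lo) k f)

  -- An excluded power may exceed `n`, so the multiples are estimated with `A = 0`, where the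
  -- harmonic constant is `1 + 1/2 + ... + 1/6`.
  ⅀-excluded : ∀ n y C → 0 < n → S * S * ⅀[ e ∈ excludedPowers y ] multiplesSum n C e ≤ excludedBound * C
  ⅀-excluded n y C 0<n = begin
    S * S * ⅀ E V                           ≡⟨ *-assoc S S _ ⟩
    S * (S * ⅀ E V)                         ≡⟨ cong (S *_) (sym (⅀-* E S V)) ⟩
    S * ⅀[ e ∈ E ] (S * V e)                ≤⟨ *-monoʳ-≤ S (⅀-mono E (λ e e∈ → multiplesSum-≤ S n C e 0 (All.lookup E-pos e∈) 0<n 0<n)) ⟩
    S * ⅀[ e ∈ E ] (h * (C ÷ e))            ≡⟨ cong (S *_) (⅀-* E h (C ÷_)) ⟩
    S * (h * ⅀ E (C ÷_))                    ≡⟨ rearr₁ S h (⅀ E (C ÷_)) ⟩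
    h * (S * ⅀ E (C ÷_))                    ≤⟨ *-monoʳ-≤ h inner ⟩
    h * ((e₀ + recip S 1000) * C)           ≡⟨ sym (*-assoc h (e₀ + recip S 1000) C) ⟩
    excludedBound * C                       ∎
    where
    open ≤-Reasoning
    E = excludedPowers y
    V = multiplesSum n C
    h = harmonicBound S 1
    E₀ = smalls
    e₀ = ⅀[ q ∈ E₀ ] recip S (q ^ suc (top q))
    rearr₁ : ∀ a b c → a * (b * c) ≡ b * (a * c)
    rearr₁ = solve-∀
    pow-pos : ∀ {q} → 2 ≤ q → ∀ k → 0 < q ^ k
    pow-pos {q} 2≤q k = m^n>0 q {{>-nonZero (<-trans z<s 2≤q)}} k
    E-pos : All (0 <_) E
    E-pos = ++⁺ (map⁺ (All.map (λ {q} 2≤q → pow-pos 2≤q (suc (top q))) smalls≥2))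
                (map⁺ (All.map (λ {q} l → let 0<q = ≤-trans z<s l in *-mono-< 0<q 0<q) (select-≥ (λ _ → true) 1001 (y ∸ 1000))))
    inner : S * ⅀ E (C ÷_) ≤ (e₀ + recip S 1000) * C
    inner = begin
      S * ⅀ E (C ÷_)
        ≡⟨ cong (S *_) (trans (⅀-++ (map _ E₀) _ (C ÷_)) (cong₂ _+_ (⅀-map _ E₀ (C ÷_))
             (trans (⅀-map _ (select (λ _ → true) 1001 (y ∸ 1000)) (C ÷_)) (⅀-select-all 1001 (y ∸ 1000) (λ q → C ÷ (q * q)))))) ⟩
      S * (⅀[ q ∈ E₀ ] (C ÷ (q ^ suc (top q))) + ∑[ q from 1001 for y ∸ 1000 ] (C ÷ (q * q)))
        ≤⟨ *-monoʳ-≤ S (+-monoʳ-≤ (⅀[ q ∈ E₀ ] (C ÷ (q ^ suc (top q)))) (∑-inverse-squares C 1000 (y ∸ 1000) z<s)) ⟩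
      S * (⅀[ q ∈ E₀ ] (C ÷ (q ^ suc (top q))) + C ÷ 1000)
        ≡⟨ *-distribˡ-+ S _ (C ÷ 1000) ⟩
      S * ⅀[ q ∈ E₀ ] (C ÷ (q ^ suc (top q))) + S * (C ÷ 1000)
        ≡⟨ cong (_+ S * (C ÷ 1000)) (sym (⅀-* E₀ S _)) ⟩
      ⅀[ q ∈ E₀ ] (S * (C ÷ (q ^ suc (top q)))) + S * (C ÷ 1000)
        ≤⟨ +-mono-≤ (⅀-mono E₀ (λ q q∈ → ≤-trans (scale-÷ S C (pow-pos (All.lookup smalls≥2 q∈) (suc (top q))))
             (≤-reflexive (*-comm _ C)))) (scale-÷ S C {1000} z<s) ⟩
      ⅀[ q ∈ E₀ ] (C * recip S (q ^ suc (top q))) + recip S 1000 * C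
        ≡⟨ cong (_+ recip S 1000 * C) (trans (⅀-* E₀ C _) (*-comm C e₀)) ⟩
      e₀ * C + recip S 1000 * C
        ≡⟨ sym (*-distribʳ-+ C e₀ (recip S 1000)) ⟩
      (e₀ + recip S 1000) * C ∎

  WeighsPrimes : List (ℕ × ℕ) → ℕ → ℕ → Set
  WeighsPrimes D K y = ∀ {p} → Prime p → p ≤ y → ∃ λ w → (p , w) ∈ D × p ^ K ≤ 2 ^ w

  not-excluded⇒covered : ∀ {D K y m} → WeighsPrimes D K y → Smooth y m →
                         (∀ {e} → e ∈ excludedPowers y → ¬ e ∣ m) → Covered D K m
  not-excluded⇒covered {D} {K} {y} {m} weighs smooth free {p} pr p∣m = weighs pr (smooth pr p∣m) , ∤m (p ≤? 1000)
    where
    E₀ = map (λ q → q ^ suc (top q)) (smalls)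
    ∤m : Dec (p ≤ 1000) → ¬ p ^ suc (top p) ∣ m
    ∤m (yes p≤) d = free (∈-++⁺ˡ (∈-map⁺ (λ q → q ^ suc (top q)) (smalls∈ pr p≤))) d
    ∤m (no p≰)  d = free (∈-++⁺ʳ E₀ (∈-map⁺ (λ q → q * q) (select-∈ (λ _ → true) 1001 (y ∸ 1000) (≰⇒> p≰)
        (s≤s (≤-trans (smooth pr p∣m) (m≤n+m∸n y 1000))) refl)))
      (subst (_∣ m) (trans (cong (λ z → p ^ suc z) (top-large (≤-trans (≤ᵇ⇒≤ 101 1001 tt) (≰⇒> p≰)))) (cong (p *_) (*-identityʳ p))) d)

  stage : ∀ n y D K G N B → 0 < n → 5 * n < y * suc y → WeighsPrimes D K y → 2 ^ G ≤ n ^ K →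
    (∀ C → N * (S * S) * ⅀[ e ∈ D ] (proj₂ e * ∑[ j from 1 for top (proj₁ e) ] multiplesSum n C (proj₁ e ^ j)) ≤ B * C) →
    B + G * (N * excludedBound) < G * (N * (S * S)) → NoCovering n
  stage n y D K G N B 0<n y-big weighs G≤ D-sum small =
    weight-criterion n y D (excludedPowers y) K G (N * (S * S)) B (N * excludedBound) 0<n y-big
      (λ {m} → not-excluded⇒covered {D} {K} {y} {m} weighs) G≤ D-sum
      (λ C → ≤-trans (≤-reflexive (*-assoc N (S * S) _))
        (≤-trans (*-monoʳ-≤ N (⅀-excluded n y C 0<n)) (≤-reflexive (sym (*-assoc N excludedBound C)))))
      small

  Within : ℕ → List (ℕ × ℕ) → Set
  Within y = All (λ e → 0 < proj₁ e × proj₁ e ≤ y)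

  recipPowers : ℕ → ℕ → ℕ
  recipPowers N q = ∑[ j from 1 for top q ] recip N (q ^ j)

  -- Up to scaling, the right side is the harmonic constant times a Mertens sum. Every `d = q ^ j`
  -- occurring satisfies `A * d < n`: for `j = 1` because `q ≤ y`, for `j ≥ 2` because `top` keeps
  -- the powers at most 10000.
  weighted-multiples-≤ : ∀ A N n y C D → 0 < n → A * y < n → A * 10000 < n → Within y D →
    N * S * ⅀[ e ∈ D ] (proj₂ e * ∑[ j from 1 for top (proj₁ e) ] multiplesSum n C (proj₁ e ^ j)) ≤
    harmonicBound S (suc A) * C * ⅀[ e ∈ D ] (proj₂ e * recipPowers N (proj₁ e))
  weighted-multiples-≤ A N n y C D 0<n Ay<n A<n within = begin
    N * S * ⅀ D f              ≡⟨ sym (⅀-* D (N * S) f) ⟩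
    ⅀[ e ∈ D ] (N * S * f e)   ≤⟨ ⅀-mono D (λ e e∈ → entry (proj₁ e) (proj₂ e) (All.lookup within e∈)) ⟩
    ⅀[ e ∈ D ] (h * C * (proj₂ e * recipPowers N (proj₁ e)))  ≡⟨ ⅀-* D (h * C) _ ⟩
    h * C * ⅀[ e ∈ D ] (proj₂ e * recipPowers N (proj₁ e))    ∎
    where
    open ≤-Reasoning
    h = harmonicBound S (suc A)
    f : ℕ × ℕ → ℕ
    f e = proj₂ e * ∑[ j from 1 for top (proj₁ e) ] multiplesSum n C (proj₁ e ^ j)
    rearr₁ : ∀ a w v → a * (w * v) ≡ w * (a * v)
    rearr₁ = solve-∀
    rearr₂ : ∀ h r C → h * (r * C) ≡ h * C * r
    rearr₂ = solve-∀
    single : ∀ d → 0 < d → A * d < n → N * S * multiplesSum n C d ≤ h * C * recip N d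
    single d 0<d Ad<n = begin
      N * S * multiplesSum n C d      ≡⟨ *-assoc N S _ ⟩
      N * (S * multiplesSum n C d)    ≤⟨ *-monoʳ-≤ N (multiplesSum-≤ S n C d A 0<d 0<n Ad<n) ⟩
      N * (h * (C ÷ d))               ≡⟨ rearr₁ N h (C ÷ d) ⟩
      h * (N * (C ÷ d))               ≤⟨ *-monoʳ-≤ h (scale-÷ N C 0<d) ⟩
      h * (recip N d * C)             ≡⟨ rearr₂ h (recip N d) C ⟩
      h * C * recip N d               ∎
    power-small : ∀ q j → q ≤ y → 1 ≤ j → j < 1 + top q → A * q ^ j < n
    power-small q 1             q≤y _ _ = ≤-<-trans (*-monoʳ-≤ A (≤-trans (≤-reflexive (*-identityʳ q)) q≤y)) Ay<n
    power-small q (suc (suc j)) q≤y _ u = ≤-<-trans (*-monoʳ-≤ A (top-power q (2 + j) (s≤s (s≤s z≤n)) (s≤s⁻¹ u))) A<n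
    entry : ∀ q w → 0 < q × q ≤ y → N * S * (w * ∑[ j from 1 for top q ] multiplesSum n C (q ^ j)) ≤ h * C * (w * recipPowers N q)
    entry q w (0<q , q≤y) = begin
      N * S * (w * ∑[ j from 1 for top q ] multiplesSum n C (q ^ j))   ≡⟨ rearr₁ (N * S) w _ ⟩
      w * (N * S * ∑[ j from 1 for top q ] multiplesSum n C (q ^ j))   ≡⟨ cong (w *_) (sym (∑-* 1 (top q) (N * S) _)) ⟩
      w * ∑[ j from 1 for top q ] (N * S * multiplesSum n C (q ^ j))   ≤⟨ *-monoʳ-≤ w (∑-mono 1 (top q) (λ j l u →
                                                                            single (q ^ j) (m^n>0 q {{>-nonZero 0<q}} j) (power-small q j q≤y l u))) ⟩
      w * ∑[ j from 1 for top q ] (h * C * recip N (q ^ j))            ≡⟨ cong (w *_) (∑-* 1 (top q) (h * C) _) ⟩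
      w * (h * C * recipPowers N q)                                    ≡⟨ rearr₁ w (h * C) (recipPowers N q) ⟩
      h * C * (w * recipPowers N q)                                    ∎

-- Tables of primes

module Table (S : ℕ) (top : ℕ → ℕ)
             (top-large : ∀ {q} → 101 ≤ q → top q ≡ 1)
             (top-power : ∀ q j → 2 ≤ j → j ≤ top q → q ^ j ≤ 10000)
             (smalls : List ℕ) (smalls≥2 : All (2 ≤_) smalls) (smalls∈ : ∀ {p} → Prime p → p ≤ 1000 → p ∈ smalls)
             (K A : ℕ) where

  open Stage S top top-large top-power smalls smalls≥2 smalls∈

  load : List (ℕ × ℕ) → ℕ
  load D = ⅀[ e ∈ D ] (proj₂ e * recipPowers S (proj₁ e))

  flog : ℕ → ℕ
  flog y = flogQuotient ((y * suc y) ^ K) (5 ^ K)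

  table : ℕ → ℕ → List ℕ → Bool
  row : ℕ → ℕ → ℕ → ℕ → List ℕ → Bool

  table y M []        = true
  table y M (y′ ∷ ys) = row y y′ (M + clog (y′ ^ K) * ⅀ (candidates (suc y) (y′ ∸ y)) (recipPowers S)) (flog y) ys

  row y y′ M G ys = (y <ᵇ y′) ∧ ((5 * (A * y′) <ᵇ y * suc y) ∧
    ((harmonicBound S (suc A) * M + G * (1 * excludedBound) <ᵇ G * (1 * (S * S))) ∧ table y′ M ys))

  table-end : ℕ → List ℕ → ℕ
  table-end y []        = y
  table-end y (y′ ∷ ys) = table-end y′ ys

  load-bound : ∀ n y D C → 0 < n → A * y < n → A * 10000 < n → Within y D →
    1 * (S * S) * ⅀[ e ∈ D ] (proj₂ e * ∑[ j from 1 for top (proj₁ e) ] multiplesSum n C (proj₁ e ^ j)) ≤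
    harmonicBound S (suc A) * load D * C
  load-bound n y D C 0<n Ay<n A<n within = begin
    1 * (S * S) * SD           ≡⟨ cong (_* SD) (*-identityˡ (S * S)) ⟩
    S * S * SD                 ≤⟨ weighted-multiples-≤ A S n y C D 0<n Ay<n A<n within ⟩
    h * C * load D             ≡⟨ swap h C (load D) ⟩
    h * load D * C             ∎
    where
    open ≤-Reasoning
    h = harmonicBound S (suc A)
    SD = ⅀[ e ∈ D ] (proj₂ e * ∑[ j from 1 for top (proj₁ e) ] multiplesSum n C (proj₁ e ^ j))
    swap : ∀ h C l → h * C * l ≡ h * l * C
    swap = solve-∀

  flog-≤ : ∀ {n y} → 2 ≤ y → y * suc y ≤ 5 * n → 2 ^ flog y ≤ n ^ K
  flog-≤ {n} {y} 2≤y h = *-cancelʳ-≤ (2 ^ flog y) (n ^ K) (5 ^ K) {{m^n≢0 5 K}} (begin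
    2 ^ flog y * 5 ^ K     ≤⟨ flogQuotient-≤ (m^n>0 (y * suc y) {{>-nonZero (≤-trans z<s 5≤)}} K) (^-monoˡ-≤ K 5≤) ⟩
    (y * suc y) ^ K        ≤⟨ ^-monoˡ-≤ K h ⟩
    (5 * n) ^ K            ≡⟨ ^-distribʳ-* K 5 n ⟩
    5 ^ K * n ^ K          ≡⟨ *-comm (5 ^ K) (n ^ K) ⟩
    n ^ K * 5 ^ K          ∎)
    where
    open ≤-Reasoning
    5≤ : 5 ≤ y * suc y
    5≤ = ≤-trans (n≤1+n 5) (*-mono-≤ 2≤y (s≤s 2≤y))

  Invariant : ℕ → ℕ → List (ℕ × ℕ) → Set
  Invariant y M D = WeighsPrimes D K y × Within y D × load D ≤ M

  initialList : ℕ → List (ℕ × ℕ)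
  initialList y = map (λ q → q , clog (q ^ K)) (candidates 2 (y ∸ 1))

  initial-invariant : ∀ y → 2 ≤ y → Invariant y (load (initialList y)) (initialList y)
  initial-invariant y 2≤y = (λ {p} pr p≤y → clog (p ^ K) , ∈-map⁺ (λ q → q , clog (q ^ K))
      (candidates-∈ 2 (y ∸ 1) (prime⇒2≤ pr) (s≤s (≤-trans p≤y (≤-reflexive (sym end)))) pr) , ≤2^clog (p ^ K)) ,
    map⁺ (All.map (λ { (l , u) → ≤-trans z<s l , ≤-trans (s≤s⁻¹ u) (≤-reflexive end) })
      (All.zip ((select-≥ _ 2 (y ∸ 1)) , (select-< _ 2 (y ∸ 1))))) ,
    ≤-refl
    where
    end : suc (y ∸ 1) ≡ y
    end = m+[n∸m]≡n (≤-trans (s≤s z≤n) 2≤y)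

  extend : ∀ {y y′ M D} → y < y′ → Invariant y M D →
           ∃ λ D′ → Invariant y′ (M + clog (y′ ^ K) * ⅀ (candidates (suc y) (y′ ∸ y)) (recipPowers S)) D′
  extend {y} {y′} {M} {D} y<y′ (weighs , within , load≤) = D ++ block , weighs′ ,
    ++⁺ (All.map (λ { (l , u) → l , ≤-trans u (<⇒≤ y<y′) }) within)
      (map⁺ (All.map (λ { {q} (l , u) → ≤-trans z<s l , s≤s⁻¹ (subst (q <_) end u) })
        (All.zip ((select-≥ _ (suc y) (y′ ∸ y)) , (select-< _ (suc y) (y′ ∸ y)))))) ,
    (begin
      load (D ++ block)           ≡⟨ ⅀-++ D block _ ⟩
      load D + load block         ≤⟨ +-mono-≤ load≤ (≤-reflexive (trans (⅀-map (_, w) new _) (⅀-* new w (recipPowers S)))) ⟩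
      M + w * ⅀ new (recipPowers S)   ∎)
    where
    open ≤-Reasoning
    w = clog (y′ ^ K)
    new = candidates (suc y) (y′ ∸ y)
    block = map (_, w) new
    end : suc y + (y′ ∸ y) ≡ suc y′
    end = cong suc (m+[n∸m]≡n (<⇒≤ y<y′))
    weighs′ : WeighsPrimes (D ++ block) K y′
    weighs′ {p} pr p≤y′ with p ≤? y
    ... | yes p≤y = let w₀ , w∈ , h = weighs pr p≤y in w₀ , ∈-++⁺ˡ w∈ , h
    ... | no p≰y  = w , ∈-++⁺ʳ D (∈-map⁺ (_, w) (candidates-∈ (suc y) (y′ ∸ y) (≰⇒> p≰y) (subst (p <_) (sym end) (s≤s p≤y′)) pr)) ,
                    ≤-trans (^-monoˡ-≤ K p≤y′) (≤2^clog (y′ ^ K))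

  table-correct : ∀ ys {n y M D} → 2 ≤ y → A * 10000 < n → table y M ys ≡ true → Invariant y M D →
                  y * suc y ≤ 5 * n → 5 * n < table-end y ys * suc (table-end y ys) → NoCovering n
  table-correct []        2≤y A<n ok inv lower upper = contradiction upper (≤⇒≯ lower)
  table-correct (y′ ∷ ys) {n} {y} {M} {D} 2≤y A<n ok inv lower upper
    with ∧-true {y <ᵇ y′} ok
  ... | y<y′ , ok₁ with ∧-true {5 * (A * y′) <ᵇ y * suc y} ok₁
  ... | Ay′< , ok₂ with ∧-true {harmonicBound S (suc A) * (M + clog (y′ ^ K) * ⅀ (candidates (suc y) (y′ ∸ y)) (recipPowers S))
                                + flog y * (1 * excludedBound) <ᵇ flog y * (1 * (S * S))} ok₂
  ... | small , ok₃ with extend (<ᵇ-true {y} y<y′) inv | 5 * n <? y′ * suc y′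
  ... | D′ , inv′ | no ≮   = table-correct ys (≤-trans 2≤y (<⇒≤ (<ᵇ-true {y} y<y′))) A<n ok₃ inv′ (≮⇒≥ ≮) upper
  ... | D′ , weighs′ , within′ , load′ | yes 5n< =
    stage n y′ D′ K (flog y) 1 (harmonicBound S (suc A) * load D′) 0<n 5n< weighs′ (flog-≤ 2≤y lower)
      (λ C → load-bound n y′ D′ C 0<n (*-cancelˡ-< 5 (A * y′) n (<-≤-trans (<ᵇ-true {5 * (A * y′)} Ay′<) lower)) A<n within′)
      (≤-<-trans (+-monoˡ-≤ (flog y * (1 * excludedBound)) (*-monoʳ-≤ (harmonicBound S (suc A)) load′)) (<ᵇ-true small))
    where
    0<n : 0 < n
    0<n = ≤-trans z<s A<n

  table-noCovering : ∀ y ys {n e} → 2 ≤ y → table y (load (initialList y)) ys ≡ true → table-end y ys ≡ e →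
                     A * 10000 < n → y * suc y ≤ 5 * n → 5 * n < e * suc e → NoCovering n
  table-noCovering y ys 2≤y ok refl A<n lower upper =
    table-correct ys 2≤y A<n ok (initial-invariant y 2≤y) lower upper

module Table₆₄ = Table 1000000000000 top top-large top-power (candidates 2 999) (select-≥ (passes trial-divisors) 2 999)
  (λ pr p≤ → candidates-∈ 2 999 (prime⇒2≤ pr) (s≤s p≤) pr) 64 33

-- The quotient of neighbouring entries, starting from 1320, grows from about 1.42 to 2, as a larger
-- `log n` leaves more room for the loss within a row.
prime-table : List ℕ
prime-table = 1872 ∷ 2718 ∷ 4090 ∷ 6328 ∷ 10150 ∷ 16878 ∷ 29058 ∷ 51870 ∷ 96268 ∷ 187360 ∷ 374720 ∷ []

noCovering-table : ∀ n → 348927 ≤ n → 5 * n < 374720 * 374721 → NoCovering n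
noCovering-table n l u = Table₆₄.table-noCovering 1320 prime-table (≤ᵇ⇒≤ 2 1320 tt) refl refl
  -- `A = 33` together with prime powers up to 10000 requires `n > 330000`; 1320 is the largest `y`
  -- with `y (y + 1) ≤ 5 * 348927`.
  (≤-trans (≤ᵇ⇒≤ 330001 348927 tt) l) (≤-trans (≤ᵇ⇒≤ (1320 * 1321) (5 * 348927) tt) (*-monoʳ-≤ 5 l)) u

-- Factorials and primorials

[2m]!≤4^m*m!² : ∀ m → (2 * m) ! ≤ 4 ^ m * (m ! * m !)
[2m]!≤4^m*m!² zero    = ≤-refl
[2m]!≤4^m*m!² (suc m) = begin
  (2 * suc m) !                                       ≡⟨ cong _! (double m) ⟩
  (2 + 2 * m) * ((1 + 2 * m) * (2 * m) !)             ≤⟨ *-monoʳ-≤ (2 + 2 * m) (*-mono-≤ (n≤1+n (1 + 2 * m)) ([2m]!≤4^m*m!² m)) ⟩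
  (2 + 2 * m) * ((2 + 2 * m) * (4 ^ m * (m ! * m !))) ≡⟨ rearr m (4 ^ m) (m !) ⟩
  4 * 4 ^ m * (suc m * m ! * (suc m * m !))           ∎
  where
  open ≤-Reasoning
  double : ∀ m → 2 * suc m ≡ 2 + 2 * m
  double = solve-∀
  rearr : ∀ m a f → (2 + 2 * m) * ((2 + 2 * m) * (a * (f * f))) ≡ 4 * a * (suc m * f * (suc m * f))
  rearr = solve-∀

-- With `M` a power of two, `log₂ (2M)!` is at most `2M + 2 log₂ M!`, and the exponent solves this
-- recurrence. Starting from `1024! ≤ 2 ^ 8770` it equals `N (log₂ N - 1.4355...)` for
-- `N = 2 ^ (10 + t)`, close to the Stirling constant `log₂ e ≈ 1.4427`.
[2^j]!-bound : ∀ j F → (2 ^ j) ! ≤ 2 ^ F → ∀ t → (2 ^ (j + t)) ! ≤ 2 ^ (2 ^ t * (F + 2 ^ j * t))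
[2^j]!-bound j F base zero    = subst₂ _≤_ (cong (λ z → (2 ^ z) !) (sym (+-identityʳ j)))
  (cong (2 ^_) (sym (trans (*-identityˡ _) (trans (cong (F +_) (*-zeroʳ (2 ^ j))) (+-identityʳ F))))) base
[2^j]!-bound j F base (suc t) = begin
  (2 ^ (j + suc t)) !                     ≡⟨ cong (λ z → (2 ^ z) !) (+-suc j t) ⟩
  (2 * M) !                               ≤⟨ [2m]!≤4^m*m!² M ⟩
  4 ^ M * (M ! * M !)                     ≤⟨ *-monoʳ-≤ (4 ^ M) (*-mono-≤ ih ih) ⟩
  4 ^ M * (2 ^ X * 2 ^ X)                 ≡⟨ cong₂ _*_ (^-*-assoc 2 2 M) (sym (^-distribˡ-+-* 2 X X)) ⟩
  2 ^ (2 * M) * 2 ^ (X + X)               ≡⟨ sym (^-distribˡ-+-* 2 (2 * M) (X + X)) ⟩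
  2 ^ (2 * M + (X + X))                   ≡⟨ cong (2 ^_) (trans (cong (λ z → 2 * z + (X + X)) (^-distribˡ-+-* 2 j t)) (rearr (2 ^ j) (2 ^ t) F t)) ⟩
  2 ^ (2 ^ suc t * (F + 2 ^ j * suc t))   ∎
  where
  open ≤-Reasoning
  M = 2 ^ (j + t)
  X = 2 ^ t * (F + 2 ^ j * t)
  ih = [2^j]!-bound j F base t
  rearr : ∀ a b F t → 2 * (a * b) + (b * (F + a * t) + b * (F + a * t)) ≡ 2 * b * (F + a * suc t)
  rearr = solve-∀

prime∣!⇒≤ : ∀ {p} → Prime p → ∀ n → p ∣ n ! → p ≤ n
prime∣!⇒≤ pr zero    p∣1 = contradiction (subst Prime (∣1⇒≡1 p∣1) pr) ¬prime[1]
prime∣!⇒≤ pr (suc n) p∣ with euclidsLemma (suc n) (n !) pr p∣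
... | inj₁ p∣sn = ∣⇒≤ p∣sn
... | inj₂ p∣n! = m≤n⇒m≤1+n (prime∣!⇒≤ pr n p∣n!)

isPrime : ℕ → Bool
isPrime q = does (prime? q)

primesFrom : ℕ → ℕ → List ℕ
primesFrom = select isPrime

select-++ : ∀ t lo a b → select t lo (a + b) ≡ select t lo a ++ select t (lo + a) b
select-++ t lo zero    b rewrite +-identityʳ lo = refl
select-++ t lo (suc a) b with t lo
... | true  = cong (lo ∷_) (trans (select-++ t (suc lo) a b) (cong (λ z → select t (suc lo) a ++ select t z b) (sym (+-suc lo a))))
... | false = trans (select-++ t (suc lo) a b) (cong (λ z → select t (suc lo) a ++ select t z b) (sym (+-suc lo a)))

primesFrom-prime : ∀ lo k → All Prime (primesFrom lo k)
primesFrom-prime lo zero    = []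
primesFrom-prime lo (suc k) with prime? lo
... | yes pr = pr ∷ primesFrom-prime (suc lo) k
... | no _   = primesFrom-prime (suc lo) k

-- If `X = c * R`, with `R` the product of the primes beyond `lo`, then a prime `lo` dividing `X`
-- must divide `c`, because all prime factors of `R` are larger than `lo`.
product-primesFrom-∣ : ∀ lo k X → (∀ {p} → Prime p → lo ≤ p → p < lo + k → p ∣ X) → product (primesFrom lo k) ∣ X
product-primesFrom-∣ lo zero    X h = 1∣ X
product-primesFrom-∣ lo (suc k) X h
  with product-primesFrom-∣ (suc lo) k X (λ {p} pr l u → h pr (<⇒≤ l) (subst (p <_) (sym (+-suc lo k)) u)) | prime? lo
... | R∣X | no _ = R∣X
... | divides c refl | yes pr with euclidsLemma c R pr (h pr ≤-refl (m<m+n lo z<s))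
  where R = product (primesFrom (suc lo) k)
... | inj₁ lo∣c = *-monoˡ-∣ (product (primesFrom (suc lo) k)) lo∣c
... | inj₂ lo∣R = contradiction (All.lookup (select-≥ isPrime (suc lo) k)
                    (factorisationHasAllPrimeFactors pr lo∣R (primesFrom-prime (suc lo) k))) (<⇒≱ ≤-refl)

[2m+1]!≤ : ∀ m → (suc (2 * m)) ! ≤ 4 ^ m * (m ! * (suc m) !)
[2m+1]!≤ zero    = ≤-refl
[2m+1]!≤ (suc m) = begin
  (suc (2 * suc m)) !                                               ≡⟨ cong (λ z → (suc z) !) (double m) ⟩
  (3 + 2 * m) * ((2 + 2 * m) * (suc (2 * m)) !)                     ≤⟨ *-mono-≤ (n≤1+n (3 + 2 * m)) (*-monoʳ-≤ (2 + 2 * m) ([2m+1]!≤ m)) ⟩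
  (4 + 2 * m) * ((2 + 2 * m) * (4 ^ m * (m ! * (suc m) !)))         ≡⟨ rearr m (4 ^ m) (m !) ((suc m) !) ⟩
  4 * 4 ^ m * (suc m * m ! * (suc (suc m) * (suc m) !))             ∎
  where
  open ≤-Reasoning
  double : ∀ m → 2 * suc m ≡ 2 + 2 * m
  double = solve-∀
  rearr : ∀ m a f g → (4 + 2 * m) * ((2 + 2 * m) * (a * (f * g))) ≡ 4 * a * (suc m * f * (suc (suc m) * g))
  rearr = solve-∀

-- These primes divide the binomial coefficient (2m+1 choose m), which is at most 4^m.
product-upper-half : ∀ m → product (primesFrom (suc (suc m)) m) ≤ 4 ^ m
product-upper-half m with k![n∸k]!∣n! {suc (2 * m)} {m} (≤-trans (m≤m+n m (m + 0)) (n≤1+n (2 * m)))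
... | divides X eq = ≤-trans (∣⇒≤ {{X≢0}} (product-primesFrom-∣ (suc (suc m)) m X p∣X)) X≤
  where
  open ≤-Reasoning
  d = m ! * (suc m) !
  instance
    d≢0 : NonZero d
    d≢0 = m !* (suc m) !≢0
  sub : suc (2 * m) ∸ m ≡ suc m
  sub = trans (cong (λ z → suc z ∸ m) (cong (m +_) (+-identityʳ m))) (trans (cong (_∸ m) (sym (+-suc m m))) (m+n∸m≡n m (suc m)))
  eq′ : (suc (2 * m)) ! ≡ X * d
  eq′ = trans eq (cong (λ z → X * (m ! * z !)) sub)
  X≤ : X ≤ 4 ^ m
  X≤ = *-cancelʳ-≤ X (4 ^ m) d (≤-trans (≤-reflexive (sym eq′)) ([2m+1]!≤ m))
  X≢0 : NonZero X
  X≢0 = ≢-nonZero λ X≡0 → ≢-nonZero⁻¹ _ {{(suc (2 * m)) !≢0}} (trans eq′ (cong (_* d) X≡0))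
  end : suc (suc m) + m ≡ suc (suc (2 * m))
  end = cong (λ z → suc (suc (m + z))) (sym (+-identityʳ m))
  p∣X : ∀ {p} → Prime p → suc (suc m) ≤ p → p < suc (suc m) + m → p ∣ X
  p∣X {zero}  pr l u = contradiction pr ¬prime[0]
  p∣X {suc p} pr l u with euclidsLemma X d pr (subst (suc p ∣_) eq′
                            (∣-trans (m∣m*n (p !)) (m≤n⇒m!∣n! (s≤s⁻¹ (subst (suc p <_) end u)))))
  ... | inj₁ p∣X = p∣X
  ... | inj₂ p∣d with euclidsLemma (m !) ((suc m) !) pr p∣d
  ... | inj₁ p∣m!  = contradiction (prime∣!⇒≤ pr m p∣m!) (<⇒≱ (≤-trans (n≤1+n (suc m)) l))
  ... | inj₂ p∣m+1! = contradiction (prime∣!⇒≤ pr (suc m) p∣m+1!) (<⇒≱ l)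

even-not-prime : ∀ m → ¬ Prime (2 * suc (suc m))
even-not-prime m pr with prime⇒irreducible pr {2} (m∣m*n (suc (suc m)))
... | inj₁ ()
... | inj₂ eq = contradiction (*-cancelˡ-≡ 1 (suc (suc m)) 2 eq) λ ()

halves : ∀ y → ∃ λ m → y ≡ 2 * m ⊎ y ≡ suc (2 * m)
halves zero    = 0 , inj₁ refl
halves (suc y) with halves y
... | m , inj₁ refl = m , inj₂ refl
... | m , inj₂ refl = suc m , inj₁ (cong suc (sym (+-suc m (m + 0))))

-- The argument of Erdős. An even `y > 2` contributes no prime. For `y = 2m + 1` the primes up to
-- `m + 1` are handled by induction and the others by the binomial coefficient. The bound `b` turns
-- this into structural recursion.
primorial-≤ : ∀ y → product (primesFrom 1 y) ≤ 4 ^ y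
primorial-≤ y = go y y ≤-refl
  where
  open ≤-Reasoning
  go : ∀ b y → y ≤ b → product (primesFrom 1 y) ≤ 4 ^ y
  go b y y≤b with halves y
  go b y y≤b | 0 , inj₁ refl = ≤-refl
  go b y y≤b | 1 , inj₁ refl = s≤s (s≤s z≤n)
  go (suc b) y y≤b | suc (suc m) , inj₁ refl = begin
    product (primesFrom 1 y)                       ≡⟨ cong (λ z → product (primesFrom 1 z)) pred-y ⟩
    product (primesFrom 1 (y′ + 1))                ≡⟨ cong product (select-++ isPrime 1 y′ 1) ⟩
    product (primesFrom 1 y′ ++ primesFrom (1 + y′) 1) ≡⟨ cong (λ z → product (primesFrom 1 y′ ++ z)) (skip (1 + y′) (subst (λ z → ¬ Prime z) (trans pred-y (+-comm y′ 1)) (even-not-prime m))) ⟩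
    product (primesFrom 1 y′ ++ [])                ≡⟨ trans (product-++ (primesFrom 1 y′) []) (*-identityʳ _) ⟩
    product (primesFrom 1 y′)                      ≤⟨ go b y′ (s≤s⁻¹ (≤-trans (≤-reflexive (trans (+-comm 1 y′) (sym pred-y))) y≤b)) ⟩
    4 ^ y′                                         ≤⟨ ^-monoʳ-≤ 4 (≤-trans (m≤m+n y′ 1) (≤-reflexive (sym pred-y))) ⟩
    4 ^ y                                          ∎
    where
    y′ = suc (2 * suc m)
    pred-y : 2 * suc (suc m) ≡ suc (2 * suc m) + 1
    pred-y = pred-double m
      where
      pred-double : ∀ m → 2 * suc (suc m) ≡ suc (2 * suc m) + 1
      pred-double = solve-∀
    skip : ∀ z → ¬ Prime z → primesFrom z 1 ≡ []
    skip z ¬pr with prime? z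
    ... | yes pr = contradiction pr ¬pr
    ... | no _   = refl
  go b y y≤b | 0 , inj₂ refl = s≤s z≤n
  go (suc b) y y≤b | suc m , inj₂ refl = begin
    product (primesFrom 1 y)                                             ≡⟨ cong (λ z → product (primesFrom 1 z)) split ⟩
    product (primesFrom 1 (suc (suc m) + suc m))                         ≡⟨ cong product (select-++ isPrime 1 (suc (suc m)) (suc m)) ⟩
    product (primesFrom 1 (suc (suc m)) ++ primesFrom (suc (suc (suc m))) (suc m)) ≡⟨ product-++ (primesFrom 1 (suc (suc m))) _ ⟩
    product (primesFrom 1 (suc (suc m))) * product (primesFrom (suc (suc (suc m))) (suc m))
                                                                         ≤⟨ *-mono-≤ (go b (suc (suc m)) (s≤s⁻¹ (≤-trans (≤-trans (s≤s (s≤s (s≤s (m≤m+n m m)))) (≤-reflexive (order m))) y≤b))) (product-upper-half (suc m)) ⟩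
    4 ^ suc (suc m) * 4 ^ suc m                                          ≡⟨ sym (^-distribˡ-+-* 4 (suc (suc m)) (suc m)) ⟩
    4 ^ (suc (suc m) + suc m)                                            ≡⟨ cong (4 ^_) (sym split) ⟩
    4 ^ y                                                                ∎
    where
    split : suc (2 * suc m) ≡ suc (suc m) + suc m
    split = split′ m
      where
      split′ : ∀ m → suc (2 * suc m) ≡ suc (suc m) + suc m
      split′ = solve-∀
    order : ∀ m → 3 + (m + m) ≡ suc (2 * suc m)
    order = solve-∀

-- The weights of all primes, for large n

∑-∈ : ∀ lo k (f : ℕ → ℕ) {a} → lo ≤ a → a < lo + k → f a ≤ ∑ lo k f
∑-∈ lo k f l u = ≤-trans (m≤m+n _ _) (∑-extract lo k f l u)

÷-≤-multiples : ∀ N d → 0 < d → N ÷ d ≤ ∑[ m from 1 for N ] ι (d ∣? m) 1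
÷-≤-multiples N d 0<d = ≤-trans (go (N ÷ d)) (∑-len-mono 1 _ (÷-*-≤ N d))
  where
  open ≤-Reasoning
  f : ℕ → ℕ
  f m = ι (d ∣? m) 1
  go : ∀ q → q ≤ ∑ 1 (q * d) f
  go zero    = z≤n
  go (suc q) = begin
    1 + q                                 ≤⟨ +-mono-≤ (≤-trans (≤-reflexive (sym (ι-yes (d ∣? suc q * d) 1 (n∣m*n (suc q)))))
                                               (∑-∈ (1 + q * d) d f {suc q * d} (+-monoˡ-≤ (q * d) 0<d) (s≤s (≤-reflexive (+-comm d (q * d)))))) (go q) ⟩
    ∑ (1 + q * d) d f + ∑ 1 (q * d) f     ≡⟨ +-comm (∑ (1 + q * d) d f) _ ⟩
    ∑ 1 (q * d) f + ∑ (1 + q * d) d f     ≡⟨ sym (∑-split 1 (q * d) d f) ⟩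
    ∑ 1 (q * d + d) f                     ≡⟨ cong (λ z → ∑ 1 z f) (+-comm (q * d) d) ⟩
    ∑ 1 (suc q * d) f                     ∎

powersDividing-∣ : ∀ q T m → q ^ powersDividing q T m ∣ m
powersDividing-∣ q zero    m = 1∣ m
powersDividing-∣ q (suc T) m with q ^ suc T ∣? m in eq
... | yes d = ∣-trans (^-∣ (powersDividing q (suc T) m) (suc T) (≤-trans (∑-mono′ 1 (suc T) λ j → ι-≤ (q ^ j ∣? m) 1)
        (≤-reflexive (∑-one 1 (suc T))))) d
  where
  ^-∣ : ∀ a b → a ≤ b → q ^ a ∣ q ^ b
  ^-∣ a b a≤b = subst (q ^ a ∣_) (trans (sym (^-distribˡ-+-* q a (b ∸ a))) (cong (q ^_) (m+[n∸m]≡n a≤b))) (m∣m*n (q ^ (b ∸ a)))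
... | no ∤m = subst (λ z → q ^ z ∣ m) (sym same) (powersDividing-∣ q T m)
  where
  same : powersDividing q (suc T) m ≡ powersDividing q T m
  same = trans (cong (λ z → ∑ 1 z (λ j → ι (q ^ j ∣? m) 1)) (+-comm 1 T))
    (trans (∑-split 1 T 1 (λ j → ι (q ^ j ∣? m) 1))
      (trans (cong (λ z → powersDividing q T m + (z + 0)) (ι-no (q ^ suc T ∣? m) 1 ∤m)) (+-identityʳ _)))

prime-power-cancel : ∀ {p q} → Prime p → Prime q → p ≢ q → ∀ j a m → p ^ j ∣ q ^ a * m → p ^ j ∣ m
prime-power-cancel {p} {q} prp prq p≢q j zero    m d = subst (p ^ j ∣_) (*-identityˡ m) d
prime-power-cancel {p} {q} prp prq p≢q j (suc a) m d =
  prime-power-cancel prp prq p≢q j a m (coprime-divisor (cop j) (subst (p ^ j ∣_) (*-assoc q (q ^ a) m) d))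
  where
  cop : ∀ j → Coprime (p ^ j) q
  cop j {i} (i∣pʲ , i∣q) with prime⇒irreducible prq i∣q
  ... | inj₁ i≡1  = i≡1
  ... | inj₂ refl = contradiction (p∣ j i∣pʲ) p≢q
    where
    p∣ : ∀ j → i ∣ p ^ j → p ≡ i
    p∣ zero    i∣1 = contradiction (subst Prime (∣1⇒≡1 i∣1) prq) ¬prime[1]
    p∣ (suc j) i∣  with euclidsLemma p (p ^ j) prq i∣
    ... | inj₂ i∣pʲ = p∣ j i∣pʲ
    ... | inj₁ i∣p with prime⇒irreducible prp i∣p
    ... | inj₁ refl = contradiction prq ¬prime[1]
    ... | inj₂ i≡p  = sym i≡p

-- The converse estimate to `covered-weight`, for weights bounded above and distinct primes. Write
-- `m = lo ^ f * c`; powers of the remaining primes that divide `m` already divide `c`, so the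
-- induction continues with `c`.
primeWeights-≤ : ∀ (w top : ℕ → ℕ) K → (∀ {q} → Prime q → 2 ^ w q ≤ q ^ K) → ∀ lo k m → 0 < m →
                 2 ^ ⅀[ q ∈ primesFrom lo k ] (w q * powersDividing q (top q) m) ≤ m ^ K
primeWeights-≤ w top K w≤ lo zero    m 0<m = m^n>0 m {{>-nonZero 0<m}} K
primeWeights-≤ w top K w≤ lo (suc k) m 0<m with prime? lo
... | no _   = primeWeights-≤ w top K w≤ (suc lo) k m 0<m
... | yes pr with powersDividing-∣ lo (top lo) m
... | divides c m≡ = begin
  2 ^ (w lo * f + ⅀ ps (g m))        ≡⟨ ^-distribˡ-+-* 2 (w lo * f) _ ⟩
  2 ^ (w lo * f) * 2 ^ ⅀ ps (g m)    ≤⟨ *-mono-≤ head (^-monoʳ-≤ 2 (⅀-mono ps λ q q∈ →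
                                          *-monoʳ-≤ (w q) (∑-mono′ 1 (top q) λ j →
                                            ι-implies (q ^ j ∣? m) (q ^ j ∣? c) 1 (descend q q∈ j)))) ⟩
  (lo ^ f) ^ K * 2 ^ ⅀ ps (g c)      ≤⟨ *-monoʳ-≤ ((lo ^ f) ^ K) (primeWeights-≤ w top K w≤ (suc lo) k c 0<c) ⟩
  (lo ^ f) ^ K * c ^ K               ≡⟨ sym (^-distribʳ-* K (lo ^ f) c) ⟩
  (lo ^ f * c) ^ K                   ≡⟨ cong (_^ K) (sym m≡′) ⟩
  m ^ K                              ∎
  where
  open ≤-Reasoning
  f = powersDividing lo (top lo) m
  ps = primesFrom (suc lo) k
  g : ℕ → ℕ → ℕ
  g m q = w q * powersDividing q (top q) m
  m≡′ : m ≡ lo ^ f * c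
  m≡′ = trans m≡ (*-comm c (lo ^ f))
  0<c : 0 < c
  0<c = n≢0⇒n>0 λ { refl → <⇒≢ 0<m (sym m≡) }
  head : 2 ^ (w lo * f) ≤ (lo ^ f) ^ K
  head = begin
    2 ^ (w lo * f)    ≡⟨ sym (^-*-assoc 2 (w lo) f) ⟩
    (2 ^ w lo) ^ f    ≤⟨ ^-monoˡ-≤ f (w≤ pr) ⟩
    (lo ^ K) ^ f      ≡⟨ trans (^-*-assoc lo K f) (trans (cong (lo ^_) (*-comm K f)) (sym (^-*-assoc lo f K))) ⟩
    (lo ^ f) ^ K      ∎
  descend : ∀ q → q ∈ ps → ∀ j → q ^ j ∣ m → q ^ j ∣ c
  descend q q∈ j d = prime-power-cancel (All.lookup (primesFrom-prime (suc lo) k) q∈) pr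
    (λ { refl → <⇒≱ ≤-refl (All.lookup (select-≥ isPrime (suc lo) k) q∈) }) j f c (subst (q ^ j ∣_) m≡′ d)

⅀-select-≤-∑ : ∀ t lo k (f : ℕ → ℕ) → ⅀ (select t lo k) f ≤ ∑ lo k f
⅀-select-≤-∑ t lo zero    f = z≤n
⅀-select-≤-∑ t lo (suc k) f with t lo
... | true  = +-monoʳ-≤ (f lo) (⅀-select-≤-∑ t (suc lo) k f)
... | false = ≤-trans (⅀-select-≤-∑ t (suc lo) k f) (m≤n+m _ (f lo))

∑-≤?-count : ∀ b a k → ∑[ q from suc a for k ] ι (q ≤? b) 1 ≤ b ∸ a
∑-≤?-count b a zero    = z≤n
∑-≤?-count b a (suc k) with suc a ≤? b
... | yes a<b = ≤-trans (s≤s (∑-≤?-count b (suc a) k)) (≤-reflexive (sym (+-∸-assoc 1 a<b)))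
... | no _    = ≤-trans (∑-≤?-count b (suc a) k) (∸-monoʳ-≤ b (n≤1+n a))

-- Since `22 * 2 ^ k = 11 * 2 ^ (k + 1)`, letting `i` run from 11 to 21 for every `s` leaves no gap,
-- and neighbouring grid values of `y` differ by a factor of at most 12/11.
grid-search : ∀ k₀ n → (∀ i s → 11 ≤ i → i < 22 → i * 2 ^ (k₀ + s) * suc (i * 2 ^ (k₀ + s)) ≤ 5 * n →
                5 * n < suc i * 2 ^ (k₀ + s) * suc (suc i * 2 ^ (k₀ + s)) → NoCovering n) →
              11 * 2 ^ k₀ * suc (11 * 2 ^ k₀) ≤ 5 * n → NoCovering n
grid-search k₀ n cases l = loop (5 * n) 0 (≤-reflexive (sym (+-identityʳ (5 * n))))
  (subst (λ z → 11 * 2 ^ z * suc (11 * 2 ^ z) ≤ 5 * n) (sym (+-identityʳ k₀)) l)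
  where
  ψ : ℕ → ℕ → ℕ
  ψ i s = i * 2 ^ (k₀ + s) * suc (i * 2 ^ (k₀ + s))
  scan : ∀ c i s → i + c ≡ 22 → 11 ≤ i → ψ i s ≤ 5 * n → NoCovering n ⊎ ψ 22 s ≤ 5 * n
  scan zero    i s eq 11≤i l = inj₂ (subst (λ z → ψ z s ≤ 5 * n) (trans (sym (+-identityʳ i)) eq) l)
  scan (suc c) i s eq 11≤i l with 5 * n <? ψ (suc i) s
  ... | yes u = inj₁ (cases i s 11≤i (subst (i <_) eq (m<m+n i z<s)) l u)
  ... | no ¬u = scan c (suc i) s (trans (sym (+-suc i c)) eq) (m≤n⇒m≤1+n 11≤i) (≮⇒≥ ¬u)
  wrap : ∀ s → 22 * 2 ^ (k₀ + s) ≡ 11 * 2 ^ (k₀ + suc s)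
  wrap s = trans (double (2 ^ (k₀ + s))) (cong (λ z → 11 * 2 ^ z) (sym (+-suc k₀ s)))
    where
    double : ∀ x → 22 * x ≡ 11 * (2 * x)
    double = solve-∀
  loop : ∀ f s → 5 * n ≤ f + s → ψ 11 s ≤ 5 * n → NoCovering n
  loop f s 5n≤ l with scan 11 11 s refl ≤-refl l
  loop f s 5n≤ l | inj₁ done = done
  -- The grid value exceeds `s`, so fuel `5 * n` cannot run out while it still satisfies `l`.
  loop zero s 5n≤ l | inj₂ _ = contradiction l (<⇒≱ (≤-<-trans 5n≤ (begin-strict
    s                                     <⟨ n<2^n s ⟩
    2 ^ s                                 ≤⟨ ^-monoʳ-≤ 2 (m≤n+m s k₀) ⟩
    2 ^ (k₀ + s)                          ≤⟨ m≤m+n _ _ ⟩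
    11 * 2 ^ (k₀ + s)                     ≤⟨ m≤m*n (11 * 2 ^ (k₀ + s)) (suc (11 * 2 ^ (k₀ + s))) ⟩
    ψ 11 s                                ∎)))
    where open ≤-Reasoning
  loop (suc f) s 5n≤ l | inj₂ next = loop f (suc s) (≤-trans 5n≤ (≤-reflexive (sym (+-suc f s))))
    (subst (λ z → z * suc z ≤ 5 * n) (wrap s) next)

module Large (S : ℕ) (top : ℕ → ℕ)
             (top-large : ∀ {q} → 101 ≤ q → top q ≡ 1)
             (top-power : ∀ q j → 2 ≤ j → j ≤ top q → q ^ j ≤ 10000)
             (smalls : List ℕ) (smalls≥2 : All (2 ≤_) smalls) (smalls∈ : ∀ {p} → Prime p → p ≤ 1000 → p ∈ smalls)
             (K A : ℕ) where

  open Stage S top top-large top-power smalls smalls≥2 smalls∈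

  primeWeight : ℕ → ℕ
  primeWeight q = clog (q ^ K)

  -- Rounding up costs a factor below 2, which is at most `q`. Raising the exponent by one thus
  -- absorbs it for all primes at once, a relative loss of `1 / K`.
  primeWeight-≤ : ∀ {q} → Prime q → 2 ^ primeWeight q ≤ q ^ suc K
  primeWeight-≤ {q} pr = ≤-trans (<⇒≤ (2^clog< (m^n>0 q {{prime⇒nonZero pr}} K))) (*-monoˡ-≤ (q ^ K) (prime⇒2≤ pr))

  weightedPrimes : ℕ → List (ℕ × ℕ)
  weightedPrimes y = map (λ q → q , primeWeight q) (primesFrom 1 y)

  weighs : ∀ y → WeighsPrimes (weightedPrimes y) K y
  weighs y {p} pr p≤y = primeWeight p , ∈-map⁺ (λ q → q , primeWeight q) (select-∈ isPrime 1 y (≤-trans z<s (prime⇒2≤ pr)) (s≤s p≤y) is) , ≤2^clog (p ^ K)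
    where
    is : isPrime p ≡ true
    is with prime? p
    ... | yes _  = refl
    ... | no ¬pr = contradiction pr ¬pr

  ⅀-primeWeight : ∀ y → ⅀ (primesFrom 1 y) primeWeight ≤ suc K * (2 * y)
  ⅀-primeWeight y = 2^-cancel-≤ (begin
    2 ^ ⅀ (primesFrom 1 y) primeWeight      ≤⟨ go (primesFrom 1 y) (primesFrom-prime 1 y) ⟩
    product (primesFrom 1 y) ^ suc K        ≤⟨ ^-monoˡ-≤ (suc K) (primorial-≤ y) ⟩
    (4 ^ y) ^ suc K                         ≡⟨ cong (_^ suc K) (^-*-assoc 2 2 y) ⟩
    (2 ^ (2 * y)) ^ suc K                   ≡⟨ trans (^-*-assoc 2 (2 * y) (suc K)) (cong (2 ^_) (*-comm (2 * y) (suc K))) ⟩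
    2 ^ (suc K * (2 * y))                   ∎)
    where
    open ≤-Reasoning
    go : ∀ ps → All Prime ps → 2 ^ ⅀ ps primeWeight ≤ product ps ^ suc K
    go []       []         = m^n>0 1 (suc K)
    go (p ∷ ps) (pr ∷ prs) = begin
      2 ^ (primeWeight p + ⅀ ps primeWeight)       ≡⟨ ^-distribˡ-+-* 2 (primeWeight p) _ ⟩
      2 ^ primeWeight p * 2 ^ ⅀ ps primeWeight     ≤⟨ *-mono-≤ (primeWeight-≤ pr) (go ps prs) ⟩
      p ^ suc K * product ps ^ suc K               ≡⟨ sym (^-distribʳ-* (suc K) p (product ps)) ⟩
      (p * product ps) ^ suc K                     ∎

  -- A prime q ≤ 100 contributes at most 14 (K + 1), because q ^ top q ≤ 10000 < 2 ^ 14.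
  ⅀-primeWeight-top : ∀ y → ⅀[ q ∈ primesFrom 1 y ] (primeWeight q * top q) ≤ suc K * (2 * y) + 14 * suc K * 100
  ⅀-primeWeight-top y = begin
    ⅀[ q ∈ ps ] (primeWeight q * top q)                          ≤⟨ ⅀-mono ps (λ q q∈ → pointwise q (All.lookup (primesFrom-prime 1 y) q∈)) ⟩
    ⅀[ q ∈ ps ] (primeWeight q + X * ι (q ≤? 100) 1)             ≡⟨ ⅀-+ ps primeWeight _ ⟩
    ⅀ ps primeWeight + ⅀[ q ∈ ps ] (X * ι (q ≤? 100) 1)          ≡⟨ cong (⅀ ps primeWeight +_) (⅀-* ps X _) ⟩
    ⅀ ps primeWeight + X * ⅀[ q ∈ ps ] ι (q ≤? 100) 1            ≤⟨ +-mono-≤ (⅀-primeWeight y) (*-monoʳ-≤ X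
                                                                      (≤-trans (⅀-select-≤-∑ isPrime 1 y _) (∑-≤?-count 100 0 y))) ⟩
    suc K * (2 * y) + X * 100                                    ∎
    where
    open ≤-Reasoning
    ps = primesFrom 1 y
    X = 14 * suc K
    q^top≤ : ∀ q → q ≤ 100 → ∀ T → (2 ≤ T → q ^ T ≤ 10000) → q ^ T ≤ 2 ^ 14
    q^top≤ q q≤ 0             h = ≤ᵇ⇒≤ 1 (2 ^ 14) tt
    q^top≤ q q≤ 1             h = ≤-trans (≤-reflexive (*-identityʳ q)) (≤-trans q≤ (≤ᵇ⇒≤ 100 (2 ^ 14) tt))
    q^top≤ q q≤ (suc (suc T)) h = ≤-trans (h (s≤s (s≤s z≤n))) (≤ᵇ⇒≤ 10000 (2 ^ 14) tt)
    small : ∀ q → Prime q → q ≤ 100 → primeWeight q * top q ≤ X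
    small q pr q≤ = 2^-cancel-≤ (begin
      2 ^ (primeWeight q * top q)      ≡⟨ sym (^-*-assoc 2 (primeWeight q) (top q)) ⟩
      (2 ^ primeWeight q) ^ top q      ≤⟨ ^-monoˡ-≤ (top q) (primeWeight-≤ pr) ⟩
      (q ^ suc K) ^ top q              ≡⟨ trans (^-*-assoc q (suc K) (top q)) (trans (cong (q ^_) (*-comm (suc K) (top q))) (sym (^-*-assoc q (top q) (suc K)))) ⟩
      (q ^ top q) ^ suc K              ≤⟨ ^-monoˡ-≤ (suc K) (q^top≤ q q≤ (top q) λ 2≤ → top-power q (top q) 2≤ ≤-refl) ⟩
      (2 ^ 14) ^ suc K                 ≡⟨ ^-*-assoc 2 14 (suc K) ⟩
      2 ^ X                            ∎)
    pointwise : ∀ q → Prime q → primeWeight q * top q ≤ primeWeight q + X * ι (q ≤? 100) 1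
    pointwise q pr with q ≤? 100
    ... | yes q≤ = ≤-trans (small q pr q≤) (≤-trans (≤-reflexive (sym (*-identityʳ X))) (m≤n+m _ (primeWeight q)))
    ... | no q≰  = ≤-trans (≤-reflexive (trans (cong (primeWeight q *_) (top-large (≰⇒> q≰))) (*-identityʳ (primeWeight q)))) (m≤m+n (primeWeight q) _)

  recipWeights : ℕ → ℕ → ℕ
  recipWeights N y = ⅀[ q ∈ primesFrom 1 y ] (primeWeight q * recipPowers N q)

  -- Summing the weights of 1 , … , N counts each prime power d N ÷ d times.
  ⅀-primeWeight-÷ : ∀ N L y → N ! ≤ 2 ^ L →
    ⅀[ q ∈ primesFrom 1 y ] (primeWeight q * ∑[ j from 1 for top q ] (N ÷ (q ^ j))) ≤ suc K * L
  ⅀-primeWeight-÷ N L y N!≤ = 2^-cancel-≤ (begin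
    2 ^ ⅀[ q ∈ ps ] (primeWeight q * ∑[ j from 1 for top q ] (N ÷ (q ^ j)))  ≤⟨ ^-monoʳ-≤ 2 count ⟩
    2 ^ ∑[ m from 1 for N ] W m                                             ≤⟨ up-to N ⟩
    (N !) ^ suc K                                                           ≤⟨ ^-monoˡ-≤ (suc K) N!≤ ⟩
    (2 ^ L) ^ suc K                                                         ≡⟨ trans (^-*-assoc 2 L (suc K)) (cong (2 ^_) (*-comm L (suc K))) ⟩
    2 ^ (suc K * L)                                                         ∎)
    where
    open ≤-Reasoning
    ps = primesFrom 1 y
    W : ℕ → ℕ
    W m = ⅀[ q ∈ ps ] (primeWeight q * powersDividing q (top q) m)
    up-to : ∀ N → 2 ^ ∑ 1 N W ≤ (N !) ^ suc K
    up-to zero    = m^n>0 1 (suc K)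
    up-to (suc N) = begin
      2 ^ ∑ 1 (suc N) W             ≡⟨ cong (2 ^_) (trans (cong (λ z → ∑ 1 z W) (+-comm 1 N)) (trans (∑-split 1 N 1 W)
                                         (trans (cong (∑ 1 N W +_) (+-identityʳ (W (suc N)))) (+-comm _ (W (suc N)))))) ⟩
      2 ^ (W (suc N) + ∑ 1 N W)     ≡⟨ ^-distribˡ-+-* 2 (W (suc N)) _ ⟩
      2 ^ W (suc N) * 2 ^ ∑ 1 N W   ≤⟨ *-mono-≤ (primeWeights-≤ primeWeight top (suc K) primeWeight-≤ 1 y (suc N) z<s) (up-to N) ⟩
      suc N ^ suc K * (N !) ^ suc K ≡⟨ sym (^-distribʳ-* (suc K) (suc N) (N !)) ⟩
      (suc N * N !) ^ suc K         ∎
    count : ⅀[ q ∈ ps ] (primeWeight q * ∑[ j from 1 for top q ] (N ÷ (q ^ j))) ≤ ∑ 1 N W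
    count = begin
      ⅀[ q ∈ ps ] (primeWeight q * ∑[ j from 1 for top q ] (N ÷ (q ^ j)))
        ≤⟨ ⅀-mono ps (λ q q∈ → *-monoʳ-≤ (primeWeight q) (∑-mono′ 1 (top q) λ j →
             ÷-≤-multiples N (q ^ j) (m^n>0 q {{prime⇒nonZero (All.lookup (primesFrom-prime 1 y) q∈)}} j))) ⟩
      ⅀[ q ∈ ps ] (primeWeight q * ∑[ j from 1 for top q ] (∑[ m from 1 for N ] ι (q ^ j ∣? m) 1))
        ≡⟨ ⅀-cong ps (λ q → trans (cong (primeWeight q *_) (∑-∑-swap 1 (top q) 1 N (λ j m → ι (q ^ j ∣? m) 1)))
             (sym (∑-* 1 N (primeWeight q) (powersDividing q (top q))))) ⟩
      ⅀[ q ∈ ps ] (∑[ m from 1 for N ] (primeWeight q * powersDividing q (top q) m))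
        ≡⟨ sym (∑-⅀-swap 1 N ps λ m q → primeWeight q * powersDividing q (top q) m) ⟩
      ∑ 1 N W ∎

  -- Scaling reciprocals by `N` makes `recip N d` equal to `1 + N ÷ d`. The quotients add up to at
  -- most the logarithm of `N !`; the ones form the rounding error, controlled by the primorial.
  recipWeights-≤ : ∀ N L y → N ! ≤ 2 ^ L → recipWeights N y ≤ suc K * (L + 2 * y + 1400)
  recipWeights-≤ N L y N!≤ = begin
    recipWeights N y
      ≡⟨ ⅀-cong ps (λ q → trans (cong (primeWeight q *_) (trans (∑-+ 1 (top q) (λ _ → 1) (λ j → N ÷ (q ^ j)))
           (cong (_+ ∑[ j from 1 for top q ] (N ÷ (q ^ j))) (∑-one 1 (top q))))) (*-distribˡ-+ (primeWeight q) (top q) _)) ⟩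
    ⅀[ q ∈ ps ] (primeWeight q * top q + primeWeight q * ∑[ j from 1 for top q ] (N ÷ (q ^ j)))
      ≡⟨ ⅀-+ ps (λ q → primeWeight q * top q) (λ q → primeWeight q * ∑[ j from 1 for top q ] (N ÷ (q ^ j))) ⟩
    ⅀[ q ∈ ps ] (primeWeight q * top q) + ⅀[ q ∈ ps ] (primeWeight q * ∑[ j from 1 for top q ] (N ÷ (q ^ j)))
      ≤⟨ +-mono-≤ (⅀-primeWeight-top y) (⅀-primeWeight-÷ N L y N!≤) ⟩
    suc K * (2 * y) + 14 * suc K * 100 + suc K * L
      ≡⟨ rearr K y L ⟩
    suc K * (L + 2 * y + 1400) ∎
    where
    open ≤-Reasoning
    ps = primesFrom 1 y
    rearr : ∀ K y L → suc K * (2 * y) + 14 * suc K * 100 + suc K * L ≡ suc K * (L + 2 * y + 1400)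
    rearr = solve-∀

  large-stage : ∀ n y N L G → 0 < n → A * y < n → A * 10000 < n → 5 * n < y * suc y → N ! ≤ 2 ^ L → 2 ^ G ≤ n ^ K →
    S * (harmonicBound S (suc A) * (suc K * (L + 2 * y + 1400))) + G * (N * excludedBound) < G * (N * (S * S)) →
    NoCovering n
  large-stage n y N L G 0<n Ay<n A<n y-big N!≤ G≤ small =
    stage n y D K G N (S * (h * (suc K * (L + 2 * y + 1400)))) 0<n y-big (weighs y) G≤ D-sum small
    where
    open ≤-Reasoning
    D = weightedPrimes y
    ps = primesFrom 1 y
    h = harmonicBound S (suc A)
    rearr₁ : ∀ N S v → N * (S * S) * v ≡ S * (N * S * v)
    rearr₁ = solve-∀
    rearr₂ : ∀ S h C r → S * (h * C * r) ≡ S * (h * r) * C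
    rearr₂ = solve-∀
    within : Within y D
    within = map⁺ (All.map (λ { (l , u) → l , s≤s⁻¹ u }) (All.zip (select-≥ isPrime 1 y , select-< isPrime 1 y)))
    D-sum : ∀ C → N * (S * S) * ⅀[ e ∈ D ] (proj₂ e * ∑[ j from 1 for top (proj₁ e) ] multiplesSum n C (proj₁ e ^ j)) ≤
                  S * (h * (suc K * (L + 2 * y + 1400))) * C
    D-sum C = begin
      N * (S * S) * SD                                   ≡⟨ rearr₁ N S SD ⟩
      S * (N * S * SD)                                   ≤⟨ *-monoʳ-≤ S (weighted-multiples-≤ A N n y C D 0<n Ay<n A<n within) ⟩
      S * (h * C * ⅀[ e ∈ D ] (proj₂ e * recipPowers N (proj₁ e)))
                                                         ≡⟨ cong (λ z → S * (h * C * z)) (⅀-map (λ q → q , primeWeight q) ps _) ⟩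
      S * (h * C * recipWeights N y)                     ≡⟨ rearr₂ S h C (recipWeights N y) ⟩
      S * (h * recipWeights N y) * C                     ≤⟨ *-monoˡ-≤ C (*-monoʳ-≤ S (*-monoʳ-≤ h (recipWeights-≤ N L y N!≤))) ⟩
      S * (h * (suc K * (L + 2 * y + 1400))) * C         ∎
      where
      SD = ⅀[ e ∈ D ] (proj₂ e * ∑[ j from 1 for top (proj₁ e) ] multiplesSum n C (proj₁ e ^ j))

  -- Below, y runs through the grid i · 2 ^ (k₀ + s), and N = 2 ^ (k₀ + e + s) is the power of two
  -- near y whose factorial is used; both sides of the final inequality are linear in s.
  start : ℕ → ℕ → ℕ → ℕ → ℕ → ℕ → Bool
  start k₀ j F i e t =
    S * (harmonicBound S (suc A) * (suc K * (2 ^ t * (F + 2 ^ j * t) + 2 * (suc i * 2 ^ k₀) + 1400))) +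
    (flogQuotient (i ^ (2 * K)) (5 ^ K) + 2 * K * k₀) * (2 ^ (k₀ + e) * excludedBound) <ᵇ
    (flogQuotient (i ^ (2 * K)) (5 ^ K) + 2 * K * k₀) * (2 ^ (k₀ + e) * (S * S))

  -- The limiting inequality, essentially `(log 6) / 2 < 1`: when `s` grows by one, `log₂ N` grows
  -- by 1 and the lower bound for `log₂ n` by 2.
  slope : Bool
  slope = S * (harmonicBound S (suc A) * suc K) + 2 * K * excludedBound <ᵇ 2 * K * (S * S)

  starts : ℕ → ℕ → ℕ → ℕ → ℕ → ℕ → ℕ → Bool
  starts k₀ j F e t lo zero    = true
  starts k₀ j F e t lo (suc c) = start k₀ j F lo e t ∧ starts k₀ j F e t (suc lo) c

  starts-lookup : ∀ k₀ j F e t lo c {i} → starts k₀ j F e t lo c ≡ true → lo ≤ i → i < lo + c → start k₀ j F i e t ≡ true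
  starts-lookup k₀ j F e t lo zero    {i} ok l u = contradiction (subst (i <_) (+-identityʳ lo) u) (≤⇒≯ l)
  starts-lookup k₀ j F e t lo (suc c) {i} ok l u with ∧-true {start k₀ j F lo e t} ok | lo ≟ i
  ... | ok₁ , _   | yes refl = ok₁
  ... | _   , ok₂ | no lo≢i  = starts-lookup k₀ j F e t (suc lo) c ok₂ (≤∧≢⇒< l lo≢i) (subst (i <_) (+-suc lo c) u)

  grid-case : ∀ k₀ j F i e t s n → (2 ^ j) ! ≤ 2 ^ F → k₀ + e ≡ j + t → 3 ≤ i → 10 * A ≤ 2 ^ k₀ →
    start k₀ j F i e t ≡ true → slope ≡ true → A * 10000 < n →
    i * 2 ^ (k₀ + s) * suc (i * 2 ^ (k₀ + s)) ≤ 5 * n → 5 * n < suc i * 2 ^ (k₀ + s) * suc (suc i * 2 ^ (k₀ + s)) →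
    NoCovering n
  grid-case k₀ j F i e t s n base k₀+e 3≤i 10A≤ start-ok slope-ok A<n lower upper =
    large-stage n Y′ (2 ^ (j + (t + s))) (2 ^ (t + s) * (F + 2 ^ j * (t + s))) G
      (≤-trans z<s A<n) AY′<n A<n upper ([2^j]!-bound j F base (t + s)) G≤ (begin-strict
        S * (h * (suc K * (2 ^ (t + s) * (F + 2 ^ j * (t + s)) + 2 * Y′ + 1400))) + G * (2 ^ (j + (t + s)) * X)
          ≤⟨ +-mono-≤ (*-monoʳ-≤ S (*-monoʳ-≤ h (*-monoʳ-≤ (suc K) L≤))) (≤-reflexive (cong (λ z → G * (z * X)) N≡)) ⟩
        S * (h * (suc K * (v * (a + N₀ * s)))) + G * (N₀ * v * X)
          -- Both sides split into `v` times a side of `start` and `v * s * N₀` times a side of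
          -- `slope`, so two computed inequalities settle every `s`.
          ≡⟨ expandˡ S h (suc K) v a N₀ s g (2 * K) X ⟩
        v * (S * (h * (suc K * a)) + g * (N₀ * X)) + v * (s * (N₀ * (S * (h * suc K) + 2 * K * X)))
          <⟨ +-mono-<-≤ (*-monoʳ-< v {{>-nonZero 0<v}} (<ᵇ-true start-ok))
               (*-monoʳ-≤ v (*-monoʳ-≤ s (*-monoʳ-≤ N₀ (<⇒≤ (<ᵇ-true slope-ok))))) ⟩
        v * (g * (N₀ * (S * S))) + v * (s * (N₀ * (2 * K * (S * S))))
          ≡⟨ expandʳ S v N₀ s g (2 * K) ⟩
        G * (N₀ * v * (S * S))
          ≡⟨ cong (λ z → G * (z * (S * S))) (sym N≡) ⟩
        G * (2 ^ (j + (t + s)) * (S * S)) ∎)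
    where
    open ≤-Reasoning
    h = harmonicBound S (suc A)
    X = excludedBound
    v = 2 ^ s
    u = 2 ^ (k₀ + s)
    Y = i * u
    Y′ = suc i * u
    N₀ = 2 ^ (k₀ + e)
    a = 2 ^ t * (F + 2 ^ j * t) + 2 * (suc i * 2 ^ k₀) + 1400
    g₀ = flogQuotient (i ^ (2 * K)) (5 ^ K)
    g = g₀ + 2 * K * k₀
    G = g + 2 * K * s
    0<v : 0 < v
    0<v = m^n>0 2 s
    expandˡ : ∀ S h k v a N s g d X → S * (h * (k * (v * (a + N * s)))) + (g + d * s) * (N * v * X) ≡
              v * (S * (h * (k * a)) + g * (N * X)) + v * (s * (N * (S * (h * k) + d * X)))
    expandˡ = solve-∀
    expandʳ : ∀ S v N s g d → v * (g * (N * (S * S))) + v * (s * (N * (d * (S * S)))) ≡ (g + d * s) * (N * v * (S * S))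
    expandʳ = solve-∀
    N≡ : 2 ^ (j + (t + s)) ≡ N₀ * v
    N≡ = trans (cong (2 ^_) (trans (sym (+-assoc j t s)) (cong (_+ s) (sym k₀+e)))) (^-distribˡ-+-* 2 (k₀ + e) s)
    L≤ : 2 ^ (t + s) * (F + 2 ^ j * (t + s)) + 2 * Y′ + 1400 ≤ v * (a + N₀ * s)
    L≤ = begin
      2 ^ (t + s) * (F + 2 ^ j * (t + s)) + 2 * (suc i * u) + 1400
        ≡⟨ cong₂ (λ y z → y * (F + 2 ^ j * (t + s)) + 2 * (suc i * z) + 1400) (^-distribˡ-+-* 2 t s) (^-distribˡ-+-* 2 k₀ s) ⟩
      2 ^ t * v * (F + 2 ^ j * (t + s)) + 2 * (suc i * (2 ^ k₀ * v)) + 1400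
        ≤⟨ +-monoʳ-≤ _ (≤-trans (≤-reflexive (sym (*-identityˡ 1400))) (*-monoˡ-≤ 1400 0<v)) ⟩
      2 ^ t * v * (F + 2 ^ j * (t + s)) + 2 * (suc i * (2 ^ k₀ * v)) + v * 1400
        ≡⟨ collect (2 ^ t) v F (2 ^ j) t s (suc i) (2 ^ k₀) 1400 ⟩
      v * (a + 2 ^ j * 2 ^ t * s)
        ≡⟨ cong (λ z → v * (a + z * s)) (trans (sym (^-distribˡ-+-* 2 j t)) (cong (2 ^_) (sym k₀+e))) ⟩
      v * (a + N₀ * s) ∎
      where
      collect : ∀ T v F J t s i k c → T * v * (F + J * (t + s)) + 2 * (i * (k * v)) + v * c ≡
                v * (T * (F + J * t) + 2 * (i * k) + c + J * T * s)
      collect = solve-∀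
    u≤Y : u ≤ Y
    u≤Y = ≤-trans (≤-reflexive (sym (*-identityˡ u))) (*-monoˡ-≤ u (≤-trans (s≤s z≤n) 3≤i))
    AY′<n : A * Y′ < n
    -- From `Y′ ≤ 2 * Y` and `10 * A ≤ 2 ^ k₀ ≤ Y` one gets `5 * A * Y′ ≤ Y * Y < 5 * n`.
    AY′<n = *-cancelˡ-< 5 (A * Y′) n (begin-strict
      5 * (A * (suc i * u))       ≤⟨ *-monoʳ-≤ 5 (*-monoʳ-≤ A (*-monoˡ-≤ u (≤-trans (+-monoˡ-≤ i (≤-trans (s≤s z≤n) 3≤i)) (≤-reflexive (cong (i +_) (sym (+-identityʳ i))))))) ⟩
      5 * (A * (2 * i * u))       ≡⟨ rearr A i u ⟩
      i * u * (10 * A)            ≤⟨ *-monoʳ-≤ (i * u) (≤-trans 10A≤ (≤-trans (^-monoʳ-≤ 2 (m≤m+n k₀ s)) u≤Y)) ⟩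
      i * u * (i * u)             <⟨ *-monoʳ-< (i * u) {{>-nonZero (≤-trans (m^n>0 2 (k₀ + s)) u≤Y)}} ≤-refl ⟩
      i * u * suc (i * u)         ≤⟨ lower ⟩
      5 * n                       ∎)
      where
      rearr : ∀ A i u → 5 * (A * (2 * i * u)) ≡ i * u * (10 * A)
      rearr = solve-∀
    5^K≤ : 5 ^ K ≤ i ^ (2 * K)
    5^K≤ = ≤-trans (^-monoˡ-≤ K (≤-trans (≤ᵇ⇒≤ 5 9 tt) (^-monoˡ-≤ 2 3≤i))) (≤-reflexive (^-*-assoc i 2 K))
    G≤ : 2 ^ G ≤ n ^ K
    G≤ = *-cancelʳ-≤ (2 ^ G) (n ^ K) (5 ^ K) {{m^n≢0 5 K}} (begin
      2 ^ G * 5 ^ K                               ≡⟨ cong (λ z → 2 ^ z * 5 ^ K) (regroup g₀ (2 * K) k₀ s) ⟩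
      2 ^ (g₀ + (k₀ + s) * (2 * K)) * 5 ^ K       ≡⟨ cong (_* 5 ^ K) (trans (^-distribˡ-+-* 2 g₀ _) (cong (2 ^ g₀ *_) (sym (^-*-assoc 2 (k₀ + s) (2 * K))))) ⟩
      2 ^ g₀ * u ^ (2 * K) * 5 ^ K                ≡⟨ swap (2 ^ g₀) (u ^ (2 * K)) (5 ^ K) ⟩
      2 ^ g₀ * 5 ^ K * u ^ (2 * K)                ≤⟨ *-monoˡ-≤ (u ^ (2 * K)) (flogQuotient-≤ (m^n>0 i {{>-nonZero (≤-trans (s≤s z≤n) 3≤i)}} (2 * K)) 5^K≤) ⟩
      i ^ (2 * K) * u ^ (2 * K)                   ≡⟨ sym (^-distribʳ-* (2 * K) i u) ⟩
      (i * u) ^ (2 * K)                           ≡⟨ sym (^-*-assoc (i * u) 2 K) ⟩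
      ((i * u) ^ 2) ^ K                           ≤⟨ ^-monoˡ-≤ K (≤-trans (*-monoʳ-≤ (i * u) (≤-trans (≤-reflexive (*-identityʳ (i * u))) (n≤1+n _))) lower) ⟩
      (5 * n) ^ K                                 ≡⟨ trans (^-distribʳ-* K 5 n) (*-comm (5 ^ K) (n ^ K)) ⟩
      n ^ K * 5 ^ K                               ∎)
      where
      regroup : ∀ g d k s → g + d * k + d * s ≡ g + (k + s) * d
      regroup = solve-∀
      swap : ∀ a b c → a * b * c ≡ a * c * b
      swap = solve-∀

  -- The exponent `e` is 4 for `i < 16` and 5 from 16 on, so `N` is the power of two with
  -- `Y′ ≤ N < 2 * Y′`. A larger `N` costs `log₂ (N / Y′)`, a smaller one increases the rounding
  -- term `2 * Y′ / N`; on this range their sum is at most 2.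
  large-noCovering : ∀ k₀ j F t n → (2 ^ j) ! ≤ 2 ^ F → k₀ + 4 ≡ j + t → 10 * A ≤ 2 ^ k₀ →
    starts k₀ j F 4 t 11 5 ≡ true → starts k₀ j F 5 (suc t) 16 6 ≡ true → slope ≡ true → A * 10000 < n →
    11 * 2 ^ k₀ * suc (11 * 2 ^ k₀) ≤ 5 * n → NoCovering n
  large-noCovering k₀ j F t n base eq 10A≤ ok₄ ok₅ slope-ok A<n = grid-search k₀ n cases
    where
    cases : ∀ i s → 11 ≤ i → i < 22 → i * 2 ^ (k₀ + s) * suc (i * 2 ^ (k₀ + s)) ≤ 5 * n →
            5 * n < suc i * 2 ^ (k₀ + s) * suc (suc i * 2 ^ (k₀ + s)) → NoCovering n
    cases i s 11≤i i<22 with i <? 16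
    ... | yes i<16 = grid-case k₀ j F i 4 t s n base eq (≤-trans (≤ᵇ⇒≤ 3 11 tt) 11≤i) 10A≤
                       (starts-lookup k₀ j F 4 t 11 5 ok₄ 11≤i i<16) slope-ok A<n
    ... | no i≮16  = grid-case k₀ j F i 5 (suc t) s n base (trans (+-suc k₀ 4) (trans (cong suc eq) (sym (+-suc j t))))
                       (≤-trans (≤ᵇ⇒≤ 3 11 tt) 11≤i) 10A≤ (starts-lookup k₀ j F 5 (suc t) 16 6 ok₅ (≮⇒≥ i≮16) i<22) slope-ok A<n

module Large₁₀₀₀ = Large 1000000000000 top top-large top-power (candidates 2 999) (select-≥ (passes trial-divisors) 2 999)
  (λ pr p≤ → candidates-∈ 2 999 (prime⇒2≤ pr) (s≤s p≤) pr) 1000 299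

noCovering-large : ∀ n → 374720 * 374721 ≤ 5 * n → NoCovering n
-- The grid starts at `11 * 2 ^ 15 = 360448`, just below the end 374720 of the table. `N` starts
-- from `2 ^ 19 = 2 ^ (10 + 9)`, and `log₂ 1024!` is slightly above 8769.
noCovering-large n l = Large₁₀₀₀.large-noCovering 15 10 8770 9 n
  (≤ᵇ⇒≤ ((2 ^ 10) !) (2 ^ 8770) tt) refl (≤ᵇ⇒≤ 2990 (2 ^ 15) tt) refl refl refl
  (*-cancelˡ-< 5 2990000 n (<-≤-trans (<ᵇ⇒< (5 * 2990000) (374720 * 374721) tt) l))
  (≤-trans (≤ᵇ⇒≤ (11 * 2 ^ 15 * suc (11 * 2 ^ 15)) (374720 * 374721) tt) l)

-- The four ranges of `n` combined

noCovering : ∀ n → 2 < n → NoCovering n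
noCovering n 2<n with n <? 13
... | yes n<13 = subst NoCovering (m+[n∸m]≡n 2<n) (noCovering-3-12 (n ∸ 3) (∸-monoˡ-< n<13 2<n))
... | no n≮13 with n <? 348927
... | yes n<348927 = noCovering-13-348926 n (≮⇒≥ n≮13) n<348927
... | no n≮348927 with 5 * n <? 374720 * 374721
... | yes small = noCovering-table n (≮⇒≥ n≮348927) small
... | no ¬small = noCovering-large n (≮⇒≥ ¬small)

theorem1 : (n : ℕ) → 2 < n →
    ¬ (∃ λ (cs : List Congruence) → IsDistinctCovering cs × ModuliIn n (6 * n) cs)
theorem1 n 2<n (cs , dc , inn) = noCovering n 2<n cs dc inn
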